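{- Let $M$ be a recursively enumerable language over a finite alphabet $\Sigma$. Then: (1) there exists an $\mathcal{E}^{\mathrm{mult}}$-grammar which generates $M$; (2) there exists an $\mathcal{E}^{r,\mathrm{mult}}$-grammar which generates $M$; (3) for each of the calculi $\mathcal{M}^{\mathrm{mult}}_{2015}$, $\mathcal{M}'^{\,\mathrm{mult}}_{2015}$, $\mathcal{F}^{\mathrm{mult}}_{2015}$, $\mathcal{M}^{\mathrm{mult}}_{2018}$, $\mathcal{M}'^{\,\mathrm{mult}}_{2018}$, $\mathcal{F}^{\mathrm{mult}}_{2018}$ there exists a grammar based on that calculus which generates $M$ both in the sense of s-recognition and in the sense of t-recognition.
   Context: Formulae are built from a countable set of variables and $\mathbf1$ by $\backslash,/,\cdot$ (multiplicative fragments: no $\wedge,\vee$) and the unary $\langle\rangle$, $[]^{ -1}$, $!$. Bracket-free calculi: sequents $\Pi\to A$ with $\Pi$ a finite (possibly empty, $\Lambda$) sequence of formulae without bracket modalities. $\mathcal{E}^{\mathrm{mult}}$ has axioms $A\to A$, $\Lambda\to\mathbf1$ and rules: ($\backslash L$) from $\Pi\to A$ and $\Delta_1,B,\Delta_2\to C$ infer $\Delta_1,\Pi,A\backslash B,\Delta_2\to C$; ($\backslash R$) from $A,\Pi\to B$ infer $\Pi\to A\backslash B$; ($/L$) from $\Pi\to A$ and $\Delta_1,B,\Delta_2\to C$ infer $\Delta_1,B/A,\Pi,\Delta_2\to C$; ($/R$) from $\Pi,A\to B$ infer $\Pi\to B/A$; ($\cdot L$) from $\Delta_1,A,B,\Delta_2\to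 C$ infer $\Delta_1,A\cdot B,\Delta_2\to C$; ($\cdot R$) from $\Gamma\to A$ and $\Delta\to B$ infer $\Gamma,\Delta\to A\cdot B$; ($\mathbf1L$) from $\Delta_1,\Delta_2\to C$ infer $\Delta_1,\mathbf1,\Delta_2\to C$; ($!R$) from $!A_1,\dots,!A_n\to B$ infer $!A_1,\dots,!A_n\to!B$ ($n\ge0$); ($!L$) from $\Delta_1,A,\Delta_2\to C$ infer $\Delta_1,!A,\Delta_2\to C$; ($!P_1$) from $\Delta_1,!A,\Phi,\Delta_2\to C$ infer $\Delta_1,\Phi,!A,\Delta_2\to C$; ($!P_2$) from $\Delta_1,\Phi,!A,\Delta_2\to C$ infer $\Delta_1,!A,\Phi,\Delta_2\to C$; ($!C$) from $\Delta_1,!A,!A,\Delta_2\to C$ infer $\Delta_1,!A,\Delta_2\to C$; ($!W$) from $\Delta_1,\Delta_2\to C$ infer $\Delta_1,!A,\Delta_2\to C$; (cut) from $\Pi\to A$ and $\Delta_1,A,\Delta_2\to C$ infer $\Delta_1,\Pi,\Delta_2\to C$. $\mathcal{E}^{r,\mathrm{mult}}$ is $\mathcal{E}^{\mathrm{mult}}$ without $!W$. Bracketed calculi with stoups: a stoup is a finite multiset of formulae; a tree term is a formula or $[\Xi]$; a meta-formula is $\zeta;\Gamma$ ($\zeta$ a stoup, $\Gamma$ a finite sequence of tree terms, empty $\Lambda$), $\varnothing;\Gamma$ written $\Gamma$; comma is concatenation / multiset union; sequents $\Xi\to C$; $\Xi(\Theta)$ designates an occurrence of a meta-formula $\Theta$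 which is $\Xi$ itself or the content of a bracket $[\Theta]$ at any depth. Common rules: axioms $A\to A$, $\Lambda\to\mathbf1$; ($/L$) from $\zeta_1;\Gamma\to B$ and $\Xi(\zeta_2;\Delta_1,C,\Delta_2)\to D$ infer $\Xi(\zeta_1,\zeta_2;\Delta_1,C/B,\Gamma,\Delta_2)\to D$; ($/R$) from $\zeta;\Gamma,B\to C$ infer $\zeta;\Gamma\to C/B$; ($\backslash L$) from $\zeta_1;\Gamma\to A$ and $\Xi(\zeta_2;\Delta_1,C,\Delta_2)\to D$ infer $\Xi(\zeta_1,\zeta_2;\Delta_1,\Gamma,A\backslash C,\Delta_2)\to D$; ($\backslash R$) from $\zeta;A,\Gamma\to C$ infer $\zeta;\Gamma\to A\backslash C$; ($\cdot L$) from $\Xi(\zeta;\Delta_1,A,B,\Delta_2)\to D$ infer $\Xi(\zeta;\Delta_1,A\cdot B,\Delta_2)\to D$; ($\cdot R$) from $\zeta_1;\Delta\to A$, $\zeta_2;\Gamma\to B$ infer $\zeta_1,\zeta_2;\Delta,\Gamma\to A\cdot B$; ($\mathbf1L$) from $\Xi(\zeta;\Delta_1,\Delta_2)\to A$ infer $\Xi(\zeta;\Delta_1,\mathbf1,\Delta_2)\to A$; ($[]^{ -1}L$) from $\Xi(\zeta;\Delta_1,A,\Delta_2)\to B$ infer $\Xi(\zeta;\Delta_1,[[]^{ -1}A],\Delta_2)\to B$; ($[]^{ -1}R$) from $[\Xi]\to A$ infer $\Xi\to[]^{ -1}A$; ($\langle\rangle L$) from $\Xi(\zeta;\Delta_1,[A],\Delta_2)\to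 B$ infer $\Xi(\zeta;\Delta_1,\langle\rangle A,\Delta_2)\to B$; ($\langle\rangle R$) from $\Xi\to A$ infer $[\Xi]\to\langle\rangle A$; ($!L$) from $\Xi(\zeta,A;\Gamma_1,\Gamma_2)\to B$ infer $\Xi(\zeta;\Gamma_1,!A,\Gamma_2)\to B$; ($!P$) from $\Xi(\zeta;\Gamma_1,A,\Gamma_2)\to B$ infer $\Xi(\zeta,A;\Gamma_1,\Gamma_2)\to B$. $\mathcal{M}^{\mathrm{mult}}_{2015}$ adds ($!R$) from $\zeta;\Lambda\to B$ infer $\zeta;\Lambda\to!B$ and ($!C$) from $\Xi(\zeta_1,\zeta_2;\Gamma_1,[\zeta_2;\Gamma_2],\Gamma_3)\to B$ infer $\Xi(\zeta_1,\zeta_2;\Gamma_1,\Gamma_2,\Gamma_3)\to B$ if $\zeta_2\ne\varnothing$. $\mathcal{M}'^{\,\mathrm{mult}}_{2015}$ adds ($!R'$) as $!R$ but only if $\zeta\ne\varnothing$, and ($!C'$) from $\Xi(\zeta_1,\zeta_2;\Gamma_1,[\zeta',\zeta_2;\Gamma_2],\Gamma_3)\to C$ infer $\Xi(\zeta_1,\zeta_2,\zeta';\Gamma_1,\Gamma_2,\Gamma_3)\to C$ if $\zeta_2\ne\varnothing$. $\mathcal{M}^{\mathrm{mult}}_{2018}$ adds ($!R$) from $!A\to B$ infer $!A\to!B$ and ($!C$) from $\Xi(\zeta,A;\Gamma_1,[A;\Gamma_2],\Gamma_3)\to B$ infer $\Xi(\zeta,A;\Gamma_1,[[\Gamma_2]],\Gamma_3)\to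 B$. $\mathcal{M}'^{\,\mathrm{mult}}_{2018}$ adds ($!R'$) from $A;\Lambda\to B$ infer $A;\Lambda\to!B$ and ($!C'$) from $\Xi(\zeta,A;\Gamma_1,[\zeta',A;\Gamma_2],\Gamma_3)\to B$ infer $\Xi(\zeta,A;\Gamma_1,[[\zeta';\Gamma_2]],\Gamma_3)\to B$. Cut is not a rule of these four. Stoup-free bracketed calculi $\mathcal{F}^{\mathrm{mult}}_{2015}$, $\mathcal{F}^{\mathrm{mult}}_{2018}$: meta-formulae are sequences of tree terms (all stoups empty); rules are the stoup-free versions of the common rules above (drop all stoups), except $!L$ is: from $\Xi(\Delta_1,A,\Delta_2)\to C$ infer $\Xi(\Delta_1,!A,\Delta_2)\to C$, together with ($!P_1$) from $\Xi(\Delta_1,!A,\Phi,\Delta_2)\to C$ infer $\Xi(\Delta_1,\Phi,!A,\Delta_2)\to C$, ($!P_2$) the converse, and (cut) from $\Pi\to A$ and $\Xi(\Gamma_1,A,\Gamma_2)\to C$ infer $\Xi(\Gamma_1,\Pi,\Gamma_2)\to C$ (no $!P$). $\mathcal{F}^{\mathrm{mult}}_{2015}$ adds ($!R$) from $!A_1,\dots,!A_n\to B$ infer $!A_1,\dots,!A_n\to!B$ ($n\ge1$) and ($!C$) from $\Xi(!A_1,\dots,!A_n,\Gamma_1,[!A_1,\dots,!A_n,\Gamma_2],\Gamma_3)\to C$ infer $\Xi(!A_1,\dots,!A_n,\Gamma_1,\Gamma_2,\Gamma_3)\to C$ ($n\ge1$); $\mathcal{F}^{\mathrm{mult}}_{2018}$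 adds ($!R$) from $!A\to B$ infer $!A\to!B$ and ($!C$) from $\Xi(!A,\Gamma_1,[!A,\Gamma_2],\Gamma_3)\to C$ infer $\Xi(!A,\Gamma_1,[[\Gamma_2]],\Gamma_3)\to C$. Grammars: an $\mathcal{L}$-grammar is a triple $\langle\Sigma,\rhd,H\rangle$ with $\Sigma$ a finite alphabet, $H$ a formula and $\rhd$ a finite relation between letters of $\Sigma$ and formulae. For a bracket-free calculus, $a_1\dots a_n$ is accepted if there are $A_i$ with $a_i\rhd A_i$ and $A_1,\dots,A_n\to H$ derivable; the grammar generates the set of accepted words. For bracketed calculi: s-recognition accepts $a_1\dots a_n$ if $A_1,\dots,A_n\to H$ (no brackets, empty stoups) is derivable for some $a_i\rhd A_i$; t-recognition accepts $a_1\dots a_n$ if $\Pi\to H$ is derivable for some meta-formula $\Pi$ with empty stoups which becomes $A_1,\dots,A_n$ after removing all brackets (but not bracket modalities), for some $a_i\rhd A_i$. The grammar generates $M$ in a given sense if the set of words accepted in that sense equals $M$. -}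

module Defs where

open import Data.Fin.Base using (Fin)
open import Data.Fin.Subset using (Subset; _∈_)
open import Data.List.Base using (List; []; _∷_; [_]; _++_; map; drop)
import Data.List.Membership.Propositional as Membership
open import Data.List.Relation.Binary.Permutation.Propositional using (_↭_)
open import Data.List.Relation.Binary.Pointwise using (Pointwise)
open import Data.Maybe.Base using (Maybe; just)
open import Data.Nat.Base using (ℕ)
open import Data.Product.Base using (∃; _×_; _,_)
open import Level using (0ℓ)
open import Relation.Binary.Construct.Closure.ReflexiveTransitive using (Star)
open import Relation.Binary.PropositionalEquality.Core using (_≡_; _≢_)
open import Relation.Unary using (Pred; _≐_)

Language : ℕ → Set₁
Language k = Pred (List (Fin k)) 0ℓ

data Symbol (k m : ℕ) : Set where
  blank : Symbol k m
  input : Fin k → Symbol k m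
  work  : Fin m → Symbol k m

data Move : Set where
  left right : Move

-- Deterministic one-tape machines with final states, the tape being infinite
-- in both directions; δ is partial, and the machine stops where it is undefined.
record TuringMachine (k : ℕ) : Set where
  field
    #states #work : ℕ

  State : Set
  State = Fin #states

  Cell : Set
  Cell = Symbol k #work

  field
    start : State
    final : Subset #states
    δ     : State → Cell → Maybe (State × Cell × Move)

  -- `before` lists the cells to the left of the head, nearest first, and
  -- `after` those to its right; all cells not listed are blank.
  record Config : Set where
    constructor config
    field
      state   : State
      before  : List Cell
      scanned : Cell
      after   : List Cell

  nearest : List Cell → Cell
  nearest []      = blank
  nearest (x ∷ _) = x

  initial : List (Fin k) → Config
  initial w = config start [] (nearest (map input w)) (drop 1 (map input w))

  perform : State × Cell × Move → List Cell → List Cell → Config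
  perform (q , x , left)  xs ys = config q (drop 1 xs) (nearest xs) (x ∷ ys)
  perform (q , x , right) xs ys = config q (x ∷ xs) (nearest ys) (drop 1 ys)

  data _⟶_ : Config → Config → Set where
    step : ∀ {q x xs ys a} → δ q x ≡ just a →
           config q xs x ys ⟶ perform a xs ys

  Accepted : Language k
  Accepted w = ∃ λ c → Star _⟶_ (initial w) c × Config.state c ∈ final

RecursivelyEnumerable : ∀ {k ℓ} → Pred (List (Fin k)) ℓ → Set ℓ
RecursivelyEnumerable {k} M =
  ∃ λ (T : TuringMachine k) → TuringMachine.Accepted T ≐ M

data Vocabulary : Set where
  bracketFree bracketed : Vocabulary

infixr 7 _∖_
infixl 7 _/_
infixl 8 _·_
infix  9 !_ ⟨⟩_ []⁻¹_

data Formula : Vocabulary → Set where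
  var         : ∀ {v} → ℕ → Formula v
  𝟙           : ∀ {v} → Formula v
  _∖_ _/_ _·_ : ∀ {v} → Formula v → Formula v → Formula v
  !_          : ∀ {v} → Formula v → Formula v
  ⟨⟩_ []⁻¹_   : Formula bracketed → Formula bracketed

data BracketFreeCalculus : Set where
  𝓔 𝓔ʳ : BracketFreeCalculus

infix 3 _⊢ᵉ_⇒_

data _⊢ᵉ_⇒_ : BracketFreeCalculus →
              List (Formula bracketFree) → Formula bracketFree → Set where

  ax  : ∀ {𝓛 A} → 𝓛 ⊢ᵉ [ A ] ⇒ A

  𝟙R  : ∀ {𝓛} → 𝓛 ⊢ᵉ [] ⇒ 𝟙

  𝟙L  : ∀ {𝓛} Δ₁ {Δ₂ C} →
        𝓛 ⊢ᵉ Δ₁ ++ Δ₂ ⇒ C →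
        𝓛 ⊢ᵉ Δ₁ ++ 𝟙 ∷ Δ₂ ⇒ C

  ∖L  : ∀ {𝓛} Δ₁ {Δ₂ Π A B C} →
        𝓛 ⊢ᵉ Π ⇒ A →
        𝓛 ⊢ᵉ Δ₁ ++ B ∷ Δ₂ ⇒ C →
        𝓛 ⊢ᵉ Δ₁ ++ Π ++ A ∖ B ∷ Δ₂ ⇒ C

  ∖R  : ∀ {𝓛 Π A B} →
        𝓛 ⊢ᵉ A ∷ Π ⇒ B →
        𝓛 ⊢ᵉ Π ⇒ A ∖ B

  /L  : ∀ {𝓛} Δ₁ {Δ₂ Π A B C} →
        𝓛 ⊢ᵉ Π ⇒ A →
        𝓛 ⊢ᵉ Δ₁ ++ B ∷ Δ₂ ⇒ C →
        𝓛 ⊢ᵉ Δ₁ ++ B / A ∷ Π ++ Δ₂ ⇒ C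

  /R  : ∀ {𝓛 Π A B} →
        𝓛 ⊢ᵉ Π ++ [ A ] ⇒ B →
        𝓛 ⊢ᵉ Π ⇒ B / A

  ·L  : ∀ {𝓛} Δ₁ {Δ₂ A B C} →
        𝓛 ⊢ᵉ Δ₁ ++ A ∷ B ∷ Δ₂ ⇒ C →
        𝓛 ⊢ᵉ Δ₁ ++ A · B ∷ Δ₂ ⇒ C

  ·R  : ∀ {𝓛 Γ Δ A B} →
        𝓛 ⊢ᵉ Γ ⇒ A →
        𝓛 ⊢ᵉ Δ ⇒ B →
        𝓛 ⊢ᵉ Γ ++ Δ ⇒ A · B

  !R  : ∀ {𝓛} As {B} →
        𝓛 ⊢ᵉ map !_ As ⇒ B →
        𝓛 ⊢ᵉ map !_ As ⇒ ! B

  !L  : ∀ {𝓛} Δ₁ {Δ₂ A C} →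
        𝓛 ⊢ᵉ Δ₁ ++ A ∷ Δ₂ ⇒ C →
        𝓛 ⊢ᵉ Δ₁ ++ ! A ∷ Δ₂ ⇒ C

  !P₁ : ∀ {𝓛} Δ₁ Φ {Δ₂ A C} →
        𝓛 ⊢ᵉ Δ₁ ++ ! A ∷ Φ ++ Δ₂ ⇒ C →
        𝓛 ⊢ᵉ Δ₁ ++ Φ ++ ! A ∷ Δ₂ ⇒ C

  !P₂ : ∀ {𝓛} Δ₁ Φ {Δ₂ A C} →
        𝓛 ⊢ᵉ Δ₁ ++ Φ ++ ! A ∷ Δ₂ ⇒ C →
        𝓛 ⊢ᵉ Δ₁ ++ ! A ∷ Φ ++ Δ₂ ⇒ C

  !C  : ∀ {𝓛} Δ₁ {Δ₂ A C} →
        𝓛 ⊢ᵉ Δ₁ ++ ! A ∷ ! A ∷ Δ₂ ⇒ C →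
        𝓛 ⊢ᵉ Δ₁ ++ ! A ∷ Δ₂ ⇒ C

  !W  : ∀ Δ₁ {Δ₂ A C} →
        𝓔 ⊢ᵉ Δ₁ ++ Δ₂ ⇒ C →
        𝓔 ⊢ᵉ Δ₁ ++ ! A ∷ Δ₂ ⇒ C

  cut : ∀ {𝓛} Δ₁ {Δ₂ Π A C} →
        𝓛 ⊢ᵉ Π ⇒ A →
        𝓛 ⊢ᵉ Δ₁ ++ A ∷ Δ₂ ⇒ C →
        𝓛 ⊢ᵉ Δ₁ ++ Π ++ Δ₂ ⇒ C

Fm : Set
Fm = Formula bracketed

data Tree : Set where
  fm : Fm → Tree
  br : List Tree → Tree

debracket : List Tree → List Fm
debracket []         = []
debracket (fm A ∷ Γ) = A ∷ debracket Γ
debracket (br Δ ∷ Γ) = debracket Δ ++ debracket Γ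

-- A context Ξ( ): the hole is either everything or the whole content of a
-- bracket.
data Context : Set where
  □      : Context
  inside : List Tree → Context → List Tree → Context

infix 6 _⟪_⟫

_⟪_⟫ : Context → List Tree → List Tree
□              ⟪ Θ ⟫ = Θ
inside Γ₁ Ξ Γ₂ ⟪ Θ ⟫ = Γ₁ ++ br (Ξ ⟪ Θ ⟫) ∷ Γ₂

!s : List Fm → List Tree
!s = map (λ A → fm (! A))

data StoupFreeCalculus : Set where
  𝓕₂₀₁₅ 𝓕₂₀₁₈ : StoupFreeCalculus

infix 3 _⊢ᶠ_⇒_

data _⊢ᶠ_⇒_ : StoupFreeCalculus → List Tree → Fm → Set where

  ax     : ∀ {𝓛 A} → 𝓛 ⊢ᶠ [ fm A ] ⇒ A

  𝟙R     : ∀ {𝓛} → 𝓛 ⊢ᶠ [] ⇒ 𝟙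

  𝟙L     : ∀ {𝓛} Ξ Δ₁ {Δ₂ A} →
           𝓛 ⊢ᶠ Ξ ⟪ Δ₁ ++ Δ₂ ⟫ ⇒ A →
           𝓛 ⊢ᶠ Ξ ⟪ Δ₁ ++ fm 𝟙 ∷ Δ₂ ⟫ ⇒ A

  /L     : ∀ {𝓛} Ξ Δ₁ {Δ₂ Γ B C D} →
           𝓛 ⊢ᶠ Γ ⇒ B →
           𝓛 ⊢ᶠ Ξ ⟪ Δ₁ ++ fm C ∷ Δ₂ ⟫ ⇒ D →
           𝓛 ⊢ᶠ Ξ ⟪ Δ₁ ++ fm (C / B) ∷ Γ ++ Δ₂ ⟫ ⇒ D

  /R     : ∀ {𝓛 Γ B C} →
           𝓛 ⊢ᶠ Γ ++ [ fm B ] ⇒ C →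
           𝓛 ⊢ᶠ Γ ⇒ C / B

  ∖L     : ∀ {𝓛} Ξ Δ₁ {Δ₂ Γ A C D} →
           𝓛 ⊢ᶠ Γ ⇒ A →
           𝓛 ⊢ᶠ Ξ ⟪ Δ₁ ++ fm C ∷ Δ₂ ⟫ ⇒ D →
           𝓛 ⊢ᶠ Ξ ⟪ Δ₁ ++ Γ ++ fm (A ∖ C) ∷ Δ₂ ⟫ ⇒ D

  ∖R     : ∀ {𝓛 Γ A C} →
           𝓛 ⊢ᶠ fm A ∷ Γ ⇒ C →
           𝓛 ⊢ᶠ Γ ⇒ A ∖ C

  ·L     : ∀ {𝓛} Ξ Δ₁ {Δ₂ A B D} →
           𝓛 ⊢ᶠ Ξ ⟪ Δ₁ ++ fm A ∷ fm B ∷ Δ₂ ⟫ ⇒ D →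
           𝓛 ⊢ᶠ Ξ ⟪ Δ₁ ++ fm (A · B) ∷ Δ₂ ⟫ ⇒ D

  ·R     : ∀ {𝓛 Δ Γ A B} →
           𝓛 ⊢ᶠ Δ ⇒ A →
           𝓛 ⊢ᶠ Γ ⇒ B →
           𝓛 ⊢ᶠ Δ ++ Γ ⇒ A · B

  []⁻¹L  : ∀ {𝓛} Ξ Δ₁ {Δ₂ A B} →
           𝓛 ⊢ᶠ Ξ ⟪ Δ₁ ++ fm A ∷ Δ₂ ⟫ ⇒ B →
           𝓛 ⊢ᶠ Ξ ⟪ Δ₁ ++ br [ fm ([]⁻¹ A) ] ∷ Δ₂ ⟫ ⇒ B

  []⁻¹R  : ∀ {𝓛 Π A} →
           𝓛 ⊢ᶠ [ br Π ] ⇒ A →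
           𝓛 ⊢ᶠ Π ⇒ []⁻¹ A

  ⟨⟩L    : ∀ {𝓛} Ξ Δ₁ {Δ₂ A B} →
           𝓛 ⊢ᶠ Ξ ⟪ Δ₁ ++ br [ fm A ] ∷ Δ₂ ⟫ ⇒ B →
           𝓛 ⊢ᶠ Ξ ⟪ Δ₁ ++ fm (⟨⟩ A) ∷ Δ₂ ⟫ ⇒ B

  ⟨⟩R    : ∀ {𝓛 Π A} →
           𝓛 ⊢ᶠ Π ⇒ A →
           𝓛 ⊢ᶠ [ br Π ] ⇒ ⟨⟩ A

  !L     : ∀ {𝓛} Ξ Δ₁ {Δ₂ A C} →
           𝓛 ⊢ᶠ Ξ ⟪ Δ₁ ++ fm A ∷ Δ₂ ⟫ ⇒ C →
           𝓛 ⊢ᶠ Ξ ⟪ Δ₁ ++ fm (! A) ∷ Δ₂ ⟫ ⇒ C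

  !P₁    : ∀ {𝓛} Ξ Δ₁ Φ {Δ₂ A C} →
           𝓛 ⊢ᶠ Ξ ⟪ Δ₁ ++ fm (! A) ∷ Φ ++ Δ₂ ⟫ ⇒ C →
           𝓛 ⊢ᶠ Ξ ⟪ Δ₁ ++ Φ ++ fm (! A) ∷ Δ₂ ⟫ ⇒ C

  !P₂    : ∀ {𝓛} Ξ Δ₁ Φ {Δ₂ A C} →
           𝓛 ⊢ᶠ Ξ ⟪ Δ₁ ++ Φ ++ fm (! A) ∷ Δ₂ ⟫ ⇒ C →
           𝓛 ⊢ᶠ Ξ ⟪ Δ₁ ++ fm (! A) ∷ Φ ++ Δ₂ ⟫ ⇒ C

  cut    : ∀ {𝓛} Ξ Γ₁ {Γ₂ Π A C} →
           𝓛 ⊢ᶠ Π ⇒ A →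
           𝓛 ⊢ᶠ Ξ ⟪ Γ₁ ++ fm A ∷ Γ₂ ⟫ ⇒ C →
           𝓛 ⊢ᶠ Ξ ⟪ Γ₁ ++ Π ++ Γ₂ ⟫ ⇒ C

  !R₂₀₁₅ : ∀ As {B} → As ≢ [] →
           𝓕₂₀₁₅ ⊢ᶠ !s As ⇒ B →
           𝓕₂₀₁₅ ⊢ᶠ !s As ⇒ ! B

  !C₂₀₁₅ : ∀ Ξ As Γ₁ Γ₂ {Γ₃ C} → As ≢ [] →
           𝓕₂₀₁₅ ⊢ᶠ Ξ ⟪ !s As ++ Γ₁ ++ br (!s As ++ Γ₂) ∷ Γ₃ ⟫ ⇒ C →
           𝓕₂₀₁₅ ⊢ᶠ Ξ ⟪ !s As ++ Γ₁ ++ Γ₂ ++ Γ₃ ⟫ ⇒ C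

  !R₂₀₁₈ : ∀ {A B} →
           𝓕₂₀₁₈ ⊢ᶠ [ fm (! A) ] ⇒ B →
           𝓕₂₀₁₈ ⊢ᶠ [ fm (! A) ] ⇒ ! B

  !C₂₀₁₈ : ∀ Ξ A Γ₁ Γ₂ {Γ₃ C} →
           𝓕₂₀₁₈ ⊢ᶠ Ξ ⟪ fm (! A) ∷ Γ₁ ++ br (fm (! A) ∷ Γ₂) ∷ Γ₃ ⟫ ⇒ C →
           𝓕₂₀₁₈ ⊢ᶠ Ξ ⟪ fm (! A) ∷ Γ₁ ++ br [ br Γ₂ ] ∷ Γ₃ ⟫ ⇒ C

-- Stoups are multisets, represented by lists; the rule `exch` below identifies
-- lists that differ only in order.
Stoup : Set
Stoup = List Fm

infix 4 _⨾_

mutual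
  data STree : Set where
    fm : Fm → STree
    br : Meta → STree

  data Meta : Set where
    _⨾_ : Stoup → List STree → Meta

data SContext : Set where
  □      : SContext
  inside : Stoup → List STree → SContext → List STree → SContext

infix 6 _⟪_⟫ˢ

_⟪_⟫ˢ : SContext → Meta → Meta
□                ⟪ Θ ⟫ˢ = Θ
inside ζ Γ₁ Ξ Γ₂ ⟪ Θ ⟫ˢ = ζ ⨾ Γ₁ ++ br (Ξ ⟪ Θ ⟫ˢ) ∷ Γ₂

emptyStoups : List Tree → List STree
emptyStoups []         = []
emptyStoups (fm A ∷ Γ) = fm A ∷ emptyStoups Γ
emptyStoups (br Δ ∷ Γ) = br ([] ⨾ emptyStoups Δ) ∷ emptyStoups Γ

data StoupCalculus : Set where
  𝓜₂₀₁₅ 𝓜′₂₀₁₅ 𝓜₂₀₁₈ 𝓜′₂₀₁₈ : StoupCalculus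

infix 3 _⊢ᵐ_⇒_

data _⊢ᵐ_⇒_ : StoupCalculus → Meta → Fm → Set where

  exch    : ∀ {𝓛} Ξ {ζ ζ′ Γ C} → ζ ↭ ζ′ →
            𝓛 ⊢ᵐ Ξ ⟪ ζ ⨾ Γ ⟫ˢ ⇒ C →
            𝓛 ⊢ᵐ Ξ ⟪ ζ′ ⨾ Γ ⟫ˢ ⇒ C

  ax      : ∀ {𝓛 A} → 𝓛 ⊢ᵐ [] ⨾ [ fm A ] ⇒ A

  𝟙R      : ∀ {𝓛} → 𝓛 ⊢ᵐ [] ⨾ [] ⇒ 𝟙

  𝟙L      : ∀ {𝓛} Ξ Δ₁ {ζ Δ₂ A} →
            𝓛 ⊢ᵐ Ξ ⟪ ζ ⨾ Δ₁ ++ Δ₂ ⟫ˢ ⇒ A →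
            𝓛 ⊢ᵐ Ξ ⟪ ζ ⨾ Δ₁ ++ fm 𝟙 ∷ Δ₂ ⟫ˢ ⇒ A

  /L      : ∀ {𝓛} Ξ Δ₁ {ζ₁ ζ₂ Δ₂ Γ B C D} →
            𝓛 ⊢ᵐ ζ₁ ⨾ Γ ⇒ B →
            𝓛 ⊢ᵐ Ξ ⟪ ζ₂ ⨾ Δ₁ ++ fm C ∷ Δ₂ ⟫ˢ ⇒ D →
            𝓛 ⊢ᵐ Ξ ⟪ ζ₁ ++ ζ₂ ⨾ Δ₁ ++ fm (C / B) ∷ Γ ++ Δ₂ ⟫ˢ ⇒ D

  /R      : ∀ {𝓛 ζ Γ B C} →
            𝓛 ⊢ᵐ ζ ⨾ Γ ++ [ fm B ] ⇒ C →
            𝓛 ⊢ᵐ ζ ⨾ Γ ⇒ C / B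

  ∖L      : ∀ {𝓛} Ξ Δ₁ {ζ₁ ζ₂ Δ₂ Γ A C D} →
            𝓛 ⊢ᵐ ζ₁ ⨾ Γ ⇒ A →
            𝓛 ⊢ᵐ Ξ ⟪ ζ₂ ⨾ Δ₁ ++ fm C ∷ Δ₂ ⟫ˢ ⇒ D →
            𝓛 ⊢ᵐ Ξ ⟪ ζ₁ ++ ζ₂ ⨾ Δ₁ ++ Γ ++ fm (A ∖ C) ∷ Δ₂ ⟫ˢ ⇒ D

  ∖R      : ∀ {𝓛 ζ Γ A C} →
            𝓛 ⊢ᵐ ζ ⨾ fm A ∷ Γ ⇒ C →
            𝓛 ⊢ᵐ ζ ⨾ Γ ⇒ A ∖ C

  ·L      : ∀ {𝓛} Ξ Δ₁ {ζ Δ₂ A B D} →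
            𝓛 ⊢ᵐ Ξ ⟪ ζ ⨾ Δ₁ ++ fm A ∷ fm B ∷ Δ₂ ⟫ˢ ⇒ D →
            𝓛 ⊢ᵐ Ξ ⟪ ζ ⨾ Δ₁ ++ fm (A · B) ∷ Δ₂ ⟫ˢ ⇒ D

  ·R      : ∀ {𝓛 ζ₁ ζ₂ Δ Γ A B} →
            𝓛 ⊢ᵐ ζ₁ ⨾ Δ ⇒ A →
            𝓛 ⊢ᵐ ζ₂ ⨾ Γ ⇒ B →
            𝓛 ⊢ᵐ ζ₁ ++ ζ₂ ⨾ Δ ++ Γ ⇒ A · B

  []⁻¹L   : ∀ {𝓛} Ξ Δ₁ {ζ Δ₂ A B} →
            𝓛 ⊢ᵐ Ξ ⟪ ζ ⨾ Δ₁ ++ fm A ∷ Δ₂ ⟫ˢ ⇒ B →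
            𝓛 ⊢ᵐ Ξ ⟪ ζ ⨾ Δ₁ ++ br ([] ⨾ [ fm ([]⁻¹ A) ]) ∷ Δ₂ ⟫ˢ ⇒ B

  []⁻¹R   : ∀ {𝓛 Θ A} →
            𝓛 ⊢ᵐ [] ⨾ [ br Θ ] ⇒ A →
            𝓛 ⊢ᵐ Θ ⇒ []⁻¹ A

  ⟨⟩L     : ∀ {𝓛} Ξ Δ₁ {ζ Δ₂ A B} →
            𝓛 ⊢ᵐ Ξ ⟪ ζ ⨾ Δ₁ ++ br ([] ⨾ [ fm A ]) ∷ Δ₂ ⟫ˢ ⇒ B →
            𝓛 ⊢ᵐ Ξ ⟪ ζ ⨾ Δ₁ ++ fm (⟨⟩ A) ∷ Δ₂ ⟫ˢ ⇒ B

  ⟨⟩R     : ∀ {𝓛 Θ A} →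
            𝓛 ⊢ᵐ Θ ⇒ A →
            𝓛 ⊢ᵐ [] ⨾ [ br Θ ] ⇒ ⟨⟩ A

  !L      : ∀ {𝓛} Ξ Γ₁ {ζ Γ₂ A B} →
            𝓛 ⊢ᵐ Ξ ⟪ ζ ++ [ A ] ⨾ Γ₁ ++ Γ₂ ⟫ˢ ⇒ B →
            𝓛 ⊢ᵐ Ξ ⟪ ζ ⨾ Γ₁ ++ fm (! A) ∷ Γ₂ ⟫ˢ ⇒ B

  !P      : ∀ {𝓛} Ξ Γ₁ {ζ Γ₂ A B} →
            𝓛 ⊢ᵐ Ξ ⟪ ζ ⨾ Γ₁ ++ fm A ∷ Γ₂ ⟫ˢ ⇒ B →
            𝓛 ⊢ᵐ Ξ ⟪ ζ ++ [ A ] ⨾ Γ₁ ++ Γ₂ ⟫ˢ ⇒ B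

  !R₂₀₁₅  : ∀ {ζ B} →
            𝓜₂₀₁₅ ⊢ᵐ ζ ⨾ [] ⇒ B →
            𝓜₂₀₁₅ ⊢ᵐ ζ ⨾ [] ⇒ ! B

  !C₂₀₁₅  : ∀ Ξ ζ₁ ζ₂ Γ₁ Γ₂ {Γ₃ B} → ζ₂ ≢ [] →
            𝓜₂₀₁₅ ⊢ᵐ Ξ ⟪ ζ₁ ++ ζ₂ ⨾ Γ₁ ++ br (ζ₂ ⨾ Γ₂) ∷ Γ₃ ⟫ˢ ⇒ B →
            𝓜₂₀₁₅ ⊢ᵐ Ξ ⟪ ζ₁ ++ ζ₂ ⨾ Γ₁ ++ Γ₂ ++ Γ₃ ⟫ˢ ⇒ B

  !R′₂₀₁₅ : ∀ {ζ B} → ζ ≢ [] →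
            𝓜′₂₀₁₅ ⊢ᵐ ζ ⨾ [] ⇒ B →
            𝓜′₂₀₁₅ ⊢ᵐ ζ ⨾ [] ⇒ ! B

  !C′₂₀₁₅ : ∀ Ξ ζ₁ ζ₂ ζ′ Γ₁ Γ₂ {Γ₃ C} → ζ₂ ≢ [] →
            𝓜′₂₀₁₅ ⊢ᵐ Ξ ⟪ ζ₁ ++ ζ₂ ⨾ Γ₁ ++ br (ζ′ ++ ζ₂ ⨾ Γ₂) ∷ Γ₃ ⟫ˢ ⇒ C →
            𝓜′₂₀₁₅ ⊢ᵐ Ξ ⟪ ζ₁ ++ ζ₂ ++ ζ′ ⨾ Γ₁ ++ Γ₂ ++ Γ₃ ⟫ˢ ⇒ C

  !R₂₀₁₈  : ∀ {A B} →
            𝓜₂₀₁₈ ⊢ᵐ [] ⨾ [ fm (! A) ] ⇒ B →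
            𝓜₂₀₁₈ ⊢ᵐ [] ⨾ [ fm (! A) ] ⇒ ! B

  !C₂₀₁₈  : ∀ Ξ ζ A Γ₁ Γ₂ {Γ₃ B} →
            𝓜₂₀₁₈ ⊢ᵐ Ξ ⟪ ζ ++ [ A ] ⨾ Γ₁ ++ br ([ A ] ⨾ Γ₂) ∷ Γ₃ ⟫ˢ ⇒ B →
            𝓜₂₀₁₈ ⊢ᵐ Ξ ⟪ ζ ++ [ A ] ⨾ Γ₁ ++ br ([] ⨾ [ br ([] ⨾ Γ₂) ]) ∷ Γ₃ ⟫ˢ ⇒ B

  !R′₂₀₁₈ : ∀ {A B} →
            𝓜′₂₀₁₈ ⊢ᵐ [ A ] ⨾ [] ⇒ B →
            𝓜′₂₀₁₈ ⊢ᵐ [ A ] ⨾ [] ⇒ ! B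

  !C′₂₀₁₈ : ∀ Ξ ζ ζ′ A Γ₁ Γ₂ {Γ₃ B} →
            𝓜′₂₀₁₈ ⊢ᵐ Ξ ⟪ ζ ++ [ A ] ⨾ Γ₁ ++ br (ζ′ ++ [ A ] ⨾ Γ₂) ∷ Γ₃ ⟫ˢ ⇒ B →
            𝓜′₂₀₁₈ ⊢ᵐ Ξ ⟪ ζ ++ [ A ] ⨾ Γ₁ ++ br ([] ⨾ [ br (ζ′ ⨾ Γ₂) ]) ∷ Γ₃ ⟫ˢ ⇒ B

data BracketedCalculus : Set where
  stoup     : StoupCalculus → BracketedCalculus
  stoupFree : StoupFreeCalculus → BracketedCalculus

-- Derivability of the sequents with empty stoups, the only ones grammars use.
infix 3 _⊢_⇒_

_⊢_⇒_ : BracketedCalculus → List Tree → Fm → Set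
stoup 𝓛     ⊢ Γ ⇒ C = 𝓛 ⊢ᵐ [] ⨾ emptyStoups Γ ⇒ C
stoupFree 𝓛 ⊢ Γ ⇒ C = 𝓛 ⊢ᶠ Γ ⇒ C

record Grammar (v : Vocabulary) (k : ℕ) : Set where
  field
    lexicon : List (Fin k × Formula v)
    goal    : Formula v

  infix 4 _▷_ _▷*_

  _▷_ : Fin k → Formula v → Set
  a ▷ A = (a , A) Membership.∈ lexicon

  _▷*_ : List (Fin k) → List (Formula v) → Set
  _▷*_ = Pointwise _▷_

module _ {k : ℕ} where

  open Grammar

  recognized : BracketFreeCalculus → Grammar bracketFree k → Language k
  recognized 𝓛 G w =
    ∃ λ As → _▷*_ G w As × 𝓛 ⊢ᵉ As ⇒ goal G

  s-recognized : BracketedCalculus → Grammar bracketed k → Language k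
  s-recognized 𝓛 G w =
    ∃ λ As → _▷*_ G w As × 𝓛 ⊢ map fm As ⇒ goal G

  t-recognized : BracketedCalculus → Grammar bracketed k → Language k
  t-recognized 𝓛 G w =
    ∃ λ Π → _▷*_ G w (debracket Π) × 𝓛 ⊢ Π ⇒ goal G

{-# OPTIONS --safe #-}
module Submission where

-- A Turing machine is simulated by string rewriting on ⊳ l q r ⊲.  A rewriting
-- rule u → v becomes the formula v / u, placed under ! in the antecedent; a word
-- w is accepted iff these formulas together with ⊳ q₀ w ⊲ derive ✓.
--
-- Each use of a rule needs a copy of its formula.  Bracketed contraction delivers
-- the copy A alone in a fresh bracket, so A is taken of the form []⁻¹(…), which
-- removes the bracket, and its body is again a ! formula, free to move to the
-- redex.  The 2018 contractions moreover turn an existing [[ ]] into the fresh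
-- bracket; hence every A also produces a new ⟨⟩⟨⟩𝟙.
--
-- Conversely, all eight calculi are sound for binary relations on a set, with
-- concatenation read as composition, brackets ignored, and !A read as the identity
-- if A contains the identity and as ∅ otherwise.  This makes ! central and
-- idempotent and validates weakening and cut.  A model on parts of machine
-- configurations then shows that only accepted words are derivable.

open import Defs
open import Data.Fin.Base using (Fin; toℕ)
open import Data.Fin.Properties using (toℕ-injective)
import Data.Fin.Subset as Subset
open import Data.Fin.Subset.Properties using (_∈?_)
open import Data.List.Base
  using (List; []; _∷_; [_]; _++_; _ʳ++_; map; foldr; drop; reverse; allFin;
         cartesianProductWith; concat; lookup)
open import Data.List.Membership.Propositional using (_∈_)
open import Data.List.Membership.Propositional.Properties
  using (∈-map⁺; ∈-map⁻; ∈-++⁺ˡ; ∈-++⁺ʳ; ∈-∃++; ∈-allFin; ∈-concat⁺′; ∈-cartesianProductWith⁺)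
open import Data.List.Properties using (++-assoc; ++-identityʳ; map-++; ʳ++-defn)
open import Data.List.Relation.Binary.Permutation.Propositional
  using (_↭_; ↭-sym; ↭-trans; ↭-reflexive)
open import Data.List.Relation.Binary.Permutation.Propositional.Properties
  using (All-resp-↭; shift; ∷↭∷ʳ)
open import Data.List.Relation.Binary.Pointwise using ([]; _∷_)
open import Data.List.Relation.Unary.All as All using (All; []; _∷_)
import Data.List.Relation.Unary.All.Properties as All
open import Data.List.Relation.Unary.Any using (here; there; index)
open import Data.List.Relation.Unary.Any.Properties using (lookup-index)
open import Data.Maybe.Base using (Maybe; just; nothing)
open import Data.Nat.Base using (ℕ)
open import Data.Product.Base using (∃; _×_; _,_; proj₁; proj₂)
open import Function.Base using (id; _∘_; _$_; case_of_)
open import Function.Definitions using (Injective)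
open import Level using (0ℓ)
open import Relation.Binary.Construct.Closure.ReflexiveTransitive using (Star; ε; _◅_)
open import Relation.Binary.Core using (Rel)
open import Relation.Binary.PropositionalEquality.Core
  using (_≡_; refl; sym; trans; cong; subst)
open import Relation.Nullary using (Dec; yes; no)
open import Relation.Unary using (Pred; _≐_)
open import Relation.Unary.Properties using (≐-trans)

private variable
  S X : Set

-- Relational composition along a list

infixr 5 _∷_

data Chain (ρ : X → Rel S 0ℓ) : List X → Rel S 0ℓ where
  []  : ∀ {x} → Chain ρ [] x x
  _∷_ : ∀ {t Γ x y z} → ρ t x y → Chain ρ Γ y z → Chain ρ (t ∷ Γ) x z

module _ {ρ : X → Rel S 0ℓ} where

  infixr 5 _⊕_

  _⊕_ : ∀ {Γ Δ x y z} → Chain ρ Γ x y → Chain ρ Δ y z → Chain ρ (Γ ++ Δ) x z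
  []      ⊕ d = d
  (a ∷ c) ⊕ d = a ∷ (c ⊕ d)

  split : ∀ Γ {Δ x z} → Chain ρ (Γ ++ Δ) x z →
          ∃ λ y → Chain ρ Γ x y × Chain ρ Δ y z
  split []      c       = _ , [] , c
  split (_ ∷ Γ) (a ∷ c) = let _ , d , e = split Γ c in _ , a ∷ d , e

  under : ∀ Δ {Γ Γ′} → (∀ {x y} → Chain ρ Γ x y → Chain ρ Γ′ x y) →
          ∀ {x y} → Chain ρ (Δ ++ Γ) x y → Chain ρ (Δ ++ Γ′) x y
  under []      f c       = f c
  under (_ ∷ Δ) f (a ∷ c) = a ∷ under Δ f c

∏ : ∀ {v} → List (Formula v) → Formula v
∏ = foldr _·_ 𝟙

-- A single formula carrying all of `As` under `!` in front of `X`: as the argument of a left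
-- implication it hands the axioms to the antecedent.
banged : ∀ {v} → List (Formula v) → Formula v → Formula v
banged As X = foldr (λ A B → ! A · B) X As

-- The relational model

module Interpretation (ρ : ℕ → Rel S 0ℓ) where

  ⟦_⟧ : ∀ {v} → Formula v → Rel S 0ℓ
  ⟦ var n  ⟧ x y = ρ n x y
  ⟦ 𝟙      ⟧ x y = x ≡ y
  ⟦ A ∖ C  ⟧ x y = ∀ w → ⟦ A ⟧ w x → ⟦ C ⟧ w y
  ⟦ C / A  ⟧ x y = ∀ z → ⟦ A ⟧ y z → ⟦ C ⟧ x z
  ⟦ A · B  ⟧ x y = ∃ λ z → ⟦ A ⟧ x z × ⟦ B ⟧ z y
  ⟦ ! A    ⟧ x y = x ≡ y × (∀ z → ⟦ A ⟧ z z)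
  ⟦ ⟨⟩ A   ⟧ x y = ⟦ A ⟧ x y
  ⟦ []⁻¹ A ⟧ x y = ⟦ A ⟧ x y

  Valid : ∀ {v} → Formula v → Set
  Valid A = ∀ x → ⟦ A ⟧ x x

  ∏⁺ : ∀ {v} {As : List (Formula v)} {x y} → Chain ⟦_⟧ As x y → ⟦ ∏ As ⟧ x y
  ∏⁺ []      = refl
  ∏⁺ (a ∷ c) = _ , a , ∏⁺ c

  banged⁺ : ∀ {v} {As} {X : Formula v} {x y} →
            All Valid As → ⟦ X ⟧ x y → ⟦ banged As X ⟧ x y
  banged⁺ []               a = a
  banged⁺ (valid ∷ valids) a = _ , (refl , valid) , banged⁺ valids a

  -- `ρ′` and `f` are kept general so that one argument serves both formulas and trees.
  bangs⁻ : ∀ {ρ′ : X → Rel S 0ℓ} {v} {f : Formula v → X} →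
           (∀ {A x y} → ρ′ (f A) x y → ⟦ ! A ⟧ x y) →
           ∀ As {x y} → Chain ρ′ (map f As) x y → x ≡ y × All Valid As
  bangs⁻ elim []       []      = refl , []
  bangs⁻ elim (A ∷ As) (a ∷ c) with refl , valid ← elim a =
    let x≡y , valids = bangs⁻ elim As c in x≡y , valid ∷ valids

  bangs⁺ : ∀ {ρ′ : X → Rel S 0ℓ} {v} {f : Formula v → X} →
           (∀ {A x y} → ⟦ ! A ⟧ x y → ρ′ (f A) x y) →
           ∀ {As x} → All Valid As → Chain ρ′ (map f As) x x
  bangs⁺ intro []               = []
  bangs⁺ intro (valid ∷ valids) = intro (refl , valid) ∷ bangs⁺ intro valids

  -- A left rule acts locally, so `under` turns a chain for its conclusion into one for its premise.
  -- For `!R`, validity mentions no particular point: if the banged formulas admit one chain, they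
  -- admit a loop at every point.
  soundᵉ : ∀ {𝓛 Γ C x y} → 𝓛 ⊢ᵉ Γ ⇒ C → Chain ⟦_⟧ Γ x y → ⟦ C ⟧ x y
  soundᵉ ax (a ∷ []) = a
  soundᵉ 𝟙R [] = refl
  soundᵉ (𝟙L Δ₁ d) c = soundᵉ d (under Δ₁ (λ { (refl ∷ c) → c }) c)
  soundᵉ (∖L Δ₁ {Π = Π} d e) c = soundᵉ e (under Δ₁
    ((λ { (_ , p , h ∷ c) → h _ (soundᵉ d p) ∷ c }) ∘ split Π) c)
  soundᵉ (∖R d) c _ a = soundᵉ d (a ∷ c)
  soundᵉ (/L Δ₁ {Π = Π} d e) c = soundᵉ e (under Δ₁
    (λ { (h ∷ c) → let _ , p , c = split Π c in h _ (soundᵉ d p) ∷ c }) c)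
  soundᵉ (/R d) c _ a = soundᵉ d (c ⊕ a ∷ [])
  soundᵉ (·L Δ₁ d) c = soundᵉ d (under Δ₁ (λ { ((_ , a , b) ∷ c) → a ∷ b ∷ c }) c)
  soundᵉ (·R {Γ = Γ} d e) c = let _ , p , q = split Γ c in _ , soundᵉ d p , soundᵉ e q
  soundᵉ (!R As d) c = let x≡y , valid = bangs⁻ id As c in
    x≡y , λ z → soundᵉ d (bangs⁺ id valid)
  soundᵉ (!L Δ₁ d) c = soundᵉ d (under Δ₁ (λ { ((refl , a) ∷ c) → a _ ∷ c }) c)
  soundᵉ (!P₁ Δ₁ Φ d) c = soundᵉ d (under Δ₁
    ((λ { (_ , p , (refl , a) ∷ c) → (refl , a) ∷ p ⊕ c }) ∘ split Φ) c)
  soundᵉ (!P₂ Δ₁ Φ d) c = soundᵉ d (under Δ₁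
    (λ { ((refl , a) ∷ c) → let _ , p , c = split Φ c in p ⊕ (refl , a) ∷ c }) c)
  soundᵉ (!C Δ₁ d) c = soundᵉ d (under Δ₁
    (λ { ((refl , a) ∷ c) → (refl , a) ∷ (refl , a) ∷ c }) c)
  soundᵉ (!W Δ₁ d) c = soundᵉ d (under Δ₁ (λ { ((refl , _) ∷ c) → c }) c)
  soundᵉ (cut Δ₁ {Π = Π} d e) c = soundᵉ e (under Δ₁
    (λ c → let _ , p , c = split Π c in soundᵉ d p ∷ c) c)

  -- Soundness of the stoup-free bracketed calculi

  data ⟦_⟧ᵗ : Tree → Rel S 0ℓ where
    fm : ∀ {A x y} → ⟦ A ⟧ x y → ⟦ fm A ⟧ᵗ x y
    br : ∀ {Γ x y} → Chain ⟦_⟧ᵗ Γ x y → ⟦ br Γ ⟧ᵗ x y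

  unfm : ∀ {A x y} → ⟦ fm A ⟧ᵗ x y → ⟦ A ⟧ x y
  unfm (fm a) = a

  replace : ∀ Ξ {Θ Θ′} → (∀ {x y} → Chain ⟦_⟧ᵗ Θ x y → Chain ⟦_⟧ᵗ Θ′ x y) →
            ∀ {x y} → Chain ⟦_⟧ᵗ (Ξ ⟪ Θ ⟫) x y → Chain ⟦_⟧ᵗ (Ξ ⟪ Θ′ ⟫) x y
  replace □                f = f
  replace (inside Γ₁ Ξ Γ₂) f = under Γ₁ (λ { (br c ∷ d) → br (replace Ξ f c) ∷ d })

  soundᶠ : ∀ {𝓛 Γ C x y} → 𝓛 ⊢ᶠ Γ ⇒ C → Chain ⟦_⟧ᵗ Γ x y → ⟦ C ⟧ x y
  soundᶠ ax (fm a ∷ []) = a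
  soundᶠ 𝟙R [] = refl
  soundᶠ (𝟙L Ξ Δ₁ d) c = soundᶠ d (replace Ξ (under Δ₁ λ { (fm refl ∷ c) → c }) c)
  soundᶠ (/L Ξ Δ₁ {Γ = Γ} d e) c = soundᶠ e (replace Ξ (under Δ₁
    λ { (fm h ∷ c) → let _ , p , c = split Γ c in fm (h _ (soundᶠ d p)) ∷ c }) c)
  soundᶠ (/R d) c _ a = soundᶠ d (c ⊕ fm a ∷ [])
  soundᶠ (∖L Ξ Δ₁ {Γ = Γ} d e) c = soundᶠ e (replace Ξ (under Δ₁
    ((λ { (_ , p , fm h ∷ c) → fm (h _ (soundᶠ d p)) ∷ c }) ∘ split Γ)) c)
  soundᶠ (∖R d) c _ a = soundᶠ d (fm a ∷ c)
  soundᶠ (·L Ξ Δ₁ d) c = soundᶠ d (replace Ξ (under Δ₁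
    λ { (fm (_ , a , b) ∷ c) → fm a ∷ fm b ∷ c }) c)
  soundᶠ (·R {Δ = Δ} d e) c = let _ , p , q = split Δ c in _ , soundᶠ d p , soundᶠ e q
  soundᶠ ([]⁻¹L Ξ Δ₁ d) c = soundᶠ d (replace Ξ (under Δ₁
    λ { (br (fm a ∷ []) ∷ c) → fm a ∷ c }) c)
  soundᶠ ([]⁻¹R d) c = soundᶠ d (br c ∷ [])
  soundᶠ (⟨⟩L Ξ Δ₁ d) c = soundᶠ d (replace Ξ (under Δ₁
    λ { (fm a ∷ c) → br (fm a ∷ []) ∷ c }) c)
  soundᶠ (⟨⟩R d) (br c ∷ []) = soundᶠ d c
  soundᶠ (!L Ξ Δ₁ d) c = soundᶠ d (replace Ξ (under Δ₁
    λ { (fm (refl , a) ∷ c) → fm (a _) ∷ c }) c)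
  soundᶠ (!P₁ Ξ Δ₁ Φ d) c = soundᶠ d (replace Ξ (under Δ₁
    ((λ { (_ , p , fm (refl , a) ∷ c) → fm (refl , a) ∷ p ⊕ c }) ∘ split Φ)) c)
  soundᶠ (!P₂ Ξ Δ₁ Φ d) c = soundᶠ d (replace Ξ (under Δ₁
    λ { (fm (refl , a) ∷ c) → let _ , p , c = split Φ c in p ⊕ fm (refl , a) ∷ c }) c)
  soundᶠ (cut Ξ Γ₁ {Π = Π} d e) c = soundᶠ e (replace Ξ (under Γ₁
    λ c → let _ , p , c = split Π c in fm (soundᶠ d p) ∷ c) c)
  soundᶠ (!R₂₀₁₅ As _ d) c = let x≡y , valid = bangs⁻ unfm As c in
    x≡y , λ z → soundᶠ d (bangs⁺ fm valid)
  soundᶠ (!C₂₀₁₅ Ξ As Γ₁ Γ₂ _ d) c = soundᶠ d (replace Ξ (λ c →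
    let _ , p , c = split (!s As) c
        _ , q , c = split Γ₁ c
        _ , r , s = split Γ₂ c
        _ , valid = bangs⁻ unfm As p
    -- The copies inside the bracket form a loop at the point where `q` ends.
    in p ⊕ q ⊕ br (bangs⁺ fm valid ⊕ r) ∷ s) c)
  soundᶠ (!R₂₀₁₈ d) (fm (refl , a) ∷ []) = refl , λ z → soundᶠ d (fm (refl , a) ∷ [])
  soundᶠ (!C₂₀₁₈ Ξ A Γ₁ Γ₂ d) c = soundᶠ d (replace Ξ
    (λ { (fm (refl , a) ∷ c) → fm (refl , a) ∷
      under Γ₁ (λ { (br (br c ∷ []) ∷ d) → br (fm (refl , a) ∷ c) ∷ d }) c }) c)

  -- Soundness of the calculi with stoups

  data ⟦_⟧ˢ : STree → Rel S 0ℓ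
  data ⟦_⟧ᵐ : Meta → Rel S 0ℓ

  data ⟦_⟧ˢ where
    fm : ∀ {A x y} → ⟦ A ⟧ x y → ⟦ fm A ⟧ˢ x y
    br : ∀ {Θ x y} → ⟦ Θ ⟧ᵐ x y → ⟦ br Θ ⟧ˢ x y

  -- A stoup only imposes that its formulas contain the identity. Order and repetition are then
  -- immaterial, which validates `exch` and the contractions.
  data ⟦_⟧ᵐ where
    _⨾_ : ∀ {ζ Γ x y} → All Valid ζ → Chain ⟦_⟧ˢ Γ x y → ⟦ ζ ⨾ Γ ⟧ᵐ x y

  replaceˢ : ∀ Ξ {Θ Θ′} → (∀ {x y} → ⟦ Θ ⟧ᵐ x y → ⟦ Θ′ ⟧ᵐ x y) →
             ∀ {x y} → ⟦ Ξ ⟪ Θ ⟫ˢ ⟧ᵐ x y → ⟦ Ξ ⟪ Θ′ ⟫ˢ ⟧ᵐ x y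
  replaceˢ □                f c       = f c
  replaceˢ (inside ζ Γ₁ Ξ Γ₂) f (v ⨾ c) =
    v ⨾ under Γ₁ (λ { (br c ∷ d) → br (replaceˢ Ξ f c) ∷ d }) c

  soundᵐ : ∀ {𝓛 Θ C x y} → 𝓛 ⊢ᵐ Θ ⇒ C → ⟦ Θ ⟧ᵐ x y → ⟦ C ⟧ x y
  soundᵐ (exch Ξ p d) c = soundᵐ d (replaceˢ Ξ (λ { (v ⨾ c) → All-resp-↭ (↭-sym p) v ⨾ c }) c)
  soundᵐ ax ([] ⨾ fm a ∷ []) = a
  soundᵐ 𝟙R ([] ⨾ []) = refl
  soundᵐ (𝟙L Ξ Δ₁ d) c = soundᵐ d (replaceˢ Ξ
    (λ { (v ⨾ c) → v ⨾ under Δ₁ (λ { (fm refl ∷ c) → c }) c }) c)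
  soundᵐ (/L Ξ Δ₁ {ζ₁} {Γ = Γ} d e) c = soundᵐ e (replaceˢ Ξ (λ { (v ⨾ c) →
    let v₁ , v₂ = All.++⁻ ζ₁ v in
    v₂ ⨾ under Δ₁ (λ { (fm h ∷ c) →
      let _ , p , c = split Γ c in fm (h _ (soundᵐ d (v₁ ⨾ p))) ∷ c }) c }) c)
  soundᵐ (/R d) (v ⨾ c) _ a = soundᵐ d (v ⨾ c ⊕ fm a ∷ [])
  soundᵐ (∖L Ξ Δ₁ {ζ₁} {Γ = Γ} d e) c = soundᵐ e (replaceˢ Ξ (λ { (v ⨾ c) →
    let v₁ , v₂ = All.++⁻ ζ₁ v in
    v₂ ⨾ under Δ₁ ((λ { (_ , p , fm h ∷ c) →
      fm (h _ (soundᵐ d (v₁ ⨾ p))) ∷ c }) ∘ split Γ) c }) c)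
  soundᵐ (∖R d) (v ⨾ c) _ a = soundᵐ d (v ⨾ fm a ∷ c)
  soundᵐ (·L Ξ Δ₁ d) c = soundᵐ d (replaceˢ Ξ
    (λ { (v ⨾ c) → v ⨾ under Δ₁ (λ { (fm (_ , a , b) ∷ c) → fm a ∷ fm b ∷ c }) c }) c)
  soundᵐ (·R {ζ₁ = ζ₁} {Δ = Δ} d e) (v ⨾ c) =
    let v₁ , v₂ = All.++⁻ ζ₁ v
        _ , p , q = split Δ c
    in _ , soundᵐ d (v₁ ⨾ p) , soundᵐ e (v₂ ⨾ q)
  soundᵐ ([]⁻¹L Ξ Δ₁ d) c = soundᵐ d (replaceˢ Ξ
    (λ { (v ⨾ c) → v ⨾ under Δ₁ (λ { (br (_ ⨾ fm a ∷ []) ∷ c) → fm a ∷ c }) c }) c)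
  soundᵐ ([]⁻¹R d) c = soundᵐ d ([] ⨾ br c ∷ [])
  soundᵐ (⟨⟩L Ξ Δ₁ d) c = soundᵐ d (replaceˢ Ξ
    (λ { (v ⨾ c) → v ⨾ under Δ₁ (λ { (fm a ∷ c) → br ([] ⨾ fm a ∷ []) ∷ c }) c }) c)
  soundᵐ (⟨⟩R d) ([] ⨾ br c ∷ []) = soundᵐ d c
  soundᵐ (!L Ξ Γ₁ d) c = soundᵐ d (replaceˢ Ξ (λ { (v ⨾ c) → case split Γ₁ c of
    λ { (_ , p , fm (refl , a) ∷ q) → All.++⁺ v (a ∷ []) ⨾ p ⊕ q } }) c)
  soundᵐ (!P Ξ Γ₁ {ζ} d) c = soundᵐ d (replaceˢ Ξ (λ { (v ⨾ c) → case All.++⁻ ζ v of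
    λ { (v , a ∷ []) → v ⨾ under Γ₁ (λ c → fm (a _) ∷ c) c } }) c)
  soundᵐ (!R₂₀₁₅ d) (v ⨾ []) = refl , λ z → soundᵐ d (v ⨾ [])
  soundᵐ (!C₂₀₁₅ Ξ ζ₁ ζ₂ Γ₁ Γ₂ _ d) c = soundᵐ d (replaceˢ Ξ (λ { (v ⨾ c) →
    let _ , v₂ = All.++⁻ ζ₁ v in
    v ⨾ under Γ₁ (λ c → let _ , p , q = split Γ₂ c in br (v₂ ⨾ p) ∷ q) c }) c)
  soundᵐ (!R′₂₀₁₅ _ d) (v ⨾ []) = refl , λ z → soundᵐ d (v ⨾ [])
  soundᵐ (!C′₂₀₁₅ Ξ ζ₁ ζ₂ ζ′ Γ₁ Γ₂ _ d) c = soundᵐ d (replaceˢ Ξ (λ { (v ⨾ c) →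
    let v₁ , w = All.++⁻ ζ₁ v
        v₂ , v′ = All.++⁻ ζ₂ w
    in All.++⁺ v₁ v₂ ⨾ under Γ₁ (λ c →
      let _ , p , q = split Γ₂ c in br (All.++⁺ v′ v₂ ⨾ p) ∷ q) c }) c)
  soundᵐ (!R₂₀₁₈ d) ([] ⨾ fm (refl , a) ∷ []) =
    refl , λ z → soundᵐ d ([] ⨾ fm (refl , a) ∷ [])
  soundᵐ (!C₂₀₁₈ Ξ ζ A Γ₁ Γ₂ d) c = soundᵐ d (replaceˢ Ξ (λ { (v ⨾ c) →
    let _ , a = All.++⁻ ζ v in
    v ⨾ under Γ₁ (λ { (br (_ ⨾ br (_ ⨾ c) ∷ []) ∷ d) → br (a ⨾ c) ∷ d }) c }) c)
  soundᵐ (!R′₂₀₁₈ d) (v ⨾ []) = refl , λ z → soundᵐ d (v ⨾ [])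
  soundᵐ (!C′₂₀₁₈ Ξ ζ ζ′ A Γ₁ Γ₂ d) c = soundᵐ d (replaceˢ Ξ (λ { (v ⨾ c) →
    let _ , a = All.++⁻ ζ v in
    v ⨾ under Γ₁ (λ { (br (_ ⨾ br (v′ ⨾ c) ∷ []) ∷ d) → br (All.++⁺ v′ a ⨾ c) ∷ d }) c }) c)

  -- Brackets do not affect the semantics, so soundness bounds t-recognition for every choice of
  -- brackets at once.
  debracket⁻ : ∀ Π {x y} → Chain ⟦_⟧ (debracket Π) x y → Chain ⟦_⟧ᵗ Π x y
  debracket⁻ []         []      = []
  debracket⁻ (fm A ∷ Γ) (a ∷ c) = fm a ∷ debracket⁻ Γ c
  debracket⁻ (br Δ ∷ Γ) c       =
    let _ , d , e = split (debracket Δ) c in br (debracket⁻ Δ d) ∷ debracket⁻ Γ e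

  emptyStoups⁺ : ∀ {Π x y} → Chain ⟦_⟧ᵗ Π x y → Chain ⟦_⟧ˢ (emptyStoups Π) x y
  emptyStoups⁺ []         = []
  emptyStoups⁺ (fm a ∷ c) = fm a ∷ emptyStoups⁺ c
  emptyStoups⁺ (br d ∷ c) = br ([] ⨾ emptyStoups⁺ d) ∷ emptyStoups⁺ c

  sound : ∀ 𝓛 {Π C x y} → 𝓛 ⊢ Π ⇒ C → Chain ⟦_⟧ (debracket Π) x y → ⟦ C ⟧ x y
  sound (stoup _)     {Π} d c = soundᵐ d ([] ⨾ emptyStoups⁺ (debracket⁻ Π c))
  sound (stoupFree _) {Π} d c = soundᶠ d (debracket⁻ Π c)

private
  map-++-++ : ∀ {A B : Set} (f : A → B) xs {ys zs} →
              map f (xs ++ ys) ++ zs ≡ map f xs ++ map f ys ++ zs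
  map-++-++ f []       = refl
  map-++-++ f (x ∷ xs) = cong (f x ∷_) (map-++-++ f xs)

-- Derivations that simulate string rewriting

data Generation : Set where
  g₂₀₁₅ g₂₀₁₈ : Generation

generationᶠ : StoupFreeCalculus → Generation
generationᶠ 𝓕₂₀₁₅ = g₂₀₁₅
generationᶠ 𝓕₂₀₁₈ = g₂₀₁₈

generationᵐ : StoupCalculus → Generation
generationᵐ 𝓜₂₀₁₅  = g₂₀₁₅
generationᵐ 𝓜′₂₀₁₅ = g₂₀₁₅
generationᵐ 𝓜₂₀₁₈  = g₂₀₁₈
generationᵐ 𝓜′₂₀₁₈ = g₂₀₁₈

generation : BracketedCalculus → Generation
generation (stoup 𝓛)     = generationᵐ 𝓛
generation (stoupFree 𝓛) = generationᶠ 𝓛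

-- A 2018 contraction consumes an empty double bracket; ⟨⟩ ⟨⟩ 𝟙 supplies one.
wrapper : Generation → Fm
wrapper g₂₀₁₅ = 𝟙
wrapper g₂₀₁₈ = ⟨⟩ ⟨⟩ 𝟙

wrapping : Generation → List Tree
wrapping g₂₀₁₅ = []
wrapping g₂₀₁₈ = [ br [ br [] ] ]

wrapper-unit : ∀ {S : Set} {ρ : ℕ → Rel S 0ℓ} g {x y} →
               Interpretation.⟦_⟧ ρ (wrapper g) x y ≡ (x ≡ y)
wrapper-unit g₂₀₁₅ = refl
wrapper-unit g₂₀₁₈ = refl

emptyStoups-fm : ∀ As → emptyStoups (map fm As) ≡ map fm As
emptyStoups-fm []       = refl
emptyStoups-fm (A ∷ As) = cong (fm A ∷_) (emptyStoups-fm As)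

debracket-fm : ∀ As → debracket (map fm As) ≡ As
debracket-fm []       = refl
debracket-fm (A ∷ As) = cong (A ∷_) (debracket-fm As)

castᵉ : ∀ {𝓛 Γ Δ C} → Γ ≡ Δ → 𝓛 ⊢ᵉ Γ ⇒ C → 𝓛 ⊢ᵉ Δ ⇒ C
castᵉ refl d = d

castᶠ : ∀ {𝓛 Γ Δ C} → Γ ≡ Δ → 𝓛 ⊢ᶠ Γ ⇒ C → 𝓛 ⊢ᶠ Δ ⇒ C
castᶠ refl d = d

castᵐ : ∀ {𝓛 ζ Γ Δ C} → Γ ≡ Δ → 𝓛 ⊢ᵐ ζ ⨾ Γ ⇒ C → 𝓛 ⊢ᵐ ζ ⨾ Δ ⇒ C
castᵐ refl d = d

-- Derived rules of the bracket-free calculi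

module _ {𝓛 : BracketFreeCalculus} where

  ∏Lᵉ : ∀ Δ As {Γ C} → 𝓛 ⊢ᵉ Δ ++ As ++ Γ ⇒ C → 𝓛 ⊢ᵉ Δ ++ ∏ As ∷ Γ ⇒ C
  ∏Lᵉ Δ []           d = 𝟙L Δ d
  ∏Lᵉ Δ (A ∷ As) {Γ} d = ·L Δ (castᵉ (++-assoc Δ [ A ] (∏ As ∷ Γ))
    (∏Lᵉ (Δ ++ [ A ]) As (castᵉ (sym (++-assoc Δ [ A ] (As ++ Γ))) d)))

  ∏Rᵉ : ∀ As → 𝓛 ⊢ᵉ As ⇒ ∏ As
  ∏Rᵉ []       = 𝟙R
  ∏Rᵉ (A ∷ As) = ·R {Γ = [ A ]} ax (∏Rᵉ As)

  -- This stands in for weakening: the axioms left at the end are absorbed by the factor `∏ axioms`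
  -- of the target.
  !∏Rᵉ : ∀ As → 𝓛 ⊢ᵉ map !_ As ⇒ ∏ As
  !∏Rᵉ []       = 𝟙R
  !∏Rᵉ (A ∷ As) = ·R {Γ = [ ! A ]} (!L [] ax) (!∏Rᵉ As)

  bangedLᵉ : ∀ Δ As {X Γ C} → 𝓛 ⊢ᵉ Δ ++ map !_ As ++ X ∷ Γ ⇒ C →
             𝓛 ⊢ᵉ Δ ++ banged As X ∷ Γ ⇒ C
  bangedLᵉ Δ []               d = d
  bangedLᵉ Δ (A ∷ As) {X} {Γ} d = ·L Δ (castᵉ (++-assoc Δ [ ! A ] _)
    (bangedLᵉ (Δ ++ [ ! A ]) As
      (castᵉ (sym (++-assoc Δ [ ! A ] (map !_ As ++ X ∷ Γ))) d)))

  contractᵉ : ∀ {A As Γ C} → A ∈ As → 𝓛 ⊢ᵉ map !_ As ++ ! A ∷ Γ ⇒ C →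
              𝓛 ⊢ᵉ map !_ As ++ Γ ⇒ C
  contractᵉ A∈As d with ys , zs , refl ← ∈-∃++ A∈As =
    castᵉ (sym (map-++-++ !_ ys))
      (!C (map !_ ys) (!P₂ (map !_ ys) (map !_ (_ ∷ zs))
        (castᵉ (map-++-++ !_ ys) d)))

  -- `B` itself may be immovable: each `! A` is moved past it in turn.
  swapᵉ : ∀ As {B Γ C} → 𝓛 ⊢ᵉ B ∷ map !_ As ++ Γ ⇒ C → 𝓛 ⊢ᵉ map !_ As ++ B ∷ Γ ⇒ C
  swapᵉ []               d = d
  swapᵉ (A ∷ As) {B} {Γ} d =
    castᵉ (++-assoc (! A ∷ map !_ As) [ B ] Γ)
      (!P₂ [] (map !_ As ++ [ B ])
        (castᵉ (sym (++-assoc (map !_ As) [ B ] (! A ∷ Γ)))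
          (swapᵉ As (!P₁ [ B ] (map !_ As) d))))

-- Derived rules of the stoup-free calculi

module _ {𝓛 : StoupFreeCalculus} where

  wrapperLᶠ : ∀ g Δ {Γ C} → 𝓛 ⊢ᶠ Δ ++ wrapping g ++ Γ ⇒ C → 𝓛 ⊢ᶠ Δ ++ fm (wrapper g) ∷ Γ ⇒ C
  wrapperLᶠ g₂₀₁₅ Δ     d = 𝟙L □ Δ d
  wrapperLᶠ g₂₀₁₈ Δ {Γ} d =
    ⟨⟩L □ Δ (⟨⟩L (inside Δ □ Γ) [] (𝟙L (inside Δ (inside [] □ []) Γ) [] d))

  wrapperRᶠ : ∀ g → 𝓛 ⊢ᶠ wrapping g ⇒ wrapper g
  wrapperRᶠ g₂₀₁₅ = 𝟙R
  wrapperRᶠ g₂₀₁₈ = ⟨⟩R (⟨⟩R 𝟙R)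

  ∏Lᶠ : ∀ Δ As {Γ C} → 𝓛 ⊢ᶠ Δ ++ map fm As ++ Γ ⇒ C → 𝓛 ⊢ᶠ Δ ++ fm (∏ As) ∷ Γ ⇒ C
  ∏Lᶠ Δ []           d = 𝟙L □ Δ d
  ∏Lᶠ Δ (A ∷ As) {Γ} d = ·L □ Δ (castᶠ (++-assoc Δ [ fm A ] (fm (∏ As) ∷ Γ))
    (∏Lᶠ (Δ ++ [ fm A ]) As
      (castᶠ (sym (++-assoc Δ [ fm A ] (map fm As ++ Γ))) d)))

  ∏Rᶠ : ∀ As → 𝓛 ⊢ᶠ map fm As ⇒ ∏ As
  ∏Rᶠ []       = 𝟙R
  ∏Rᶠ (A ∷ As) = ·R {Δ = [ fm A ]} ax (∏Rᶠ As)

  !∏Rᶠ : ∀ As → 𝓛 ⊢ᶠ !s As ⇒ ∏ As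
  !∏Rᶠ []       = 𝟙R
  !∏Rᶠ (A ∷ As) = ·R {Δ = [ fm (! A) ]} (!L □ [] ax) (!∏Rᶠ As)

  bangedLᶠ : ∀ Δ As {X Γ C} → 𝓛 ⊢ᶠ Δ ++ !s As ++ fm X ∷ Γ ⇒ C →
             𝓛 ⊢ᶠ Δ ++ fm (banged As X) ∷ Γ ⇒ C
  bangedLᶠ Δ []               d = d
  bangedLᶠ Δ (A ∷ As) {X} {Γ} d = ·L □ Δ (castᶠ (++-assoc Δ [ fm (! A) ] _)
    (bangedLᶠ (Δ ++ [ fm (! A) ]) As
      (castᶠ (sym (++-assoc Δ [ fm (! A) ] (!s As ++ fm X ∷ Γ))) d)))

  -- With the sequence `Γ₂` of the contraction rule empty, the copy is alone in its bracket; the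
  -- generations then differ only in whether a double bracket is consumed.
  contract₁ᶠ : ∀ A Δ {Γ C} → 𝓛 ⊢ᶠ fm (! A) ∷ Δ ++ br [ fm (! A) ] ∷ Γ ⇒ C →
               𝓛 ⊢ᶠ fm (! A) ∷ Δ ++ wrapping (generationᶠ 𝓛) ++ Γ ⇒ C
  contract₁ᶠ A Δ {Γ} = go 𝓛
    where
    go : ∀ 𝓛 {C} → 𝓛 ⊢ᶠ fm (! A) ∷ Δ ++ br [ fm (! A) ] ∷ Γ ⇒ C →
         𝓛 ⊢ᶠ fm (! A) ∷ Δ ++ wrapping (generationᶠ 𝓛) ++ Γ ⇒ C
    go 𝓕₂₀₁₅ d = !C₂₀₁₅ □ [ A ] Δ [] (λ ()) d
    go 𝓕₂₀₁₈ d = !C₂₀₁₈ □ A Δ [] d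

  -- Contraction wants the formula at the left end, so the chosen axiom is moved to the front,
  -- contracted there and moved back.
  contractᶠ : ∀ {A As Γ C} → A ∈ As → 𝓛 ⊢ᶠ !s As ++ br [ fm (! A) ] ∷ Γ ⇒ C →
              𝓛 ⊢ᶠ !s As ++ wrapping (generationᶠ 𝓛) ++ Γ ⇒ C
  contractᶠ {A} {Γ = Γ} A∈As d with ys , zs , refl ← ∈-∃++ A∈As =
    castᶠ (sym (map-++-++ _ ys)) (!P₁ □ [] (!s ys)
      (castᶠ (cong (fm (! A) ∷_) (++-assoc (!s ys) (!s zs) _))
        (contract₁ᶠ A (!s ys ++ !s zs)
          (castᶠ (cong (fm (! A) ∷_) (sym (++-assoc (!s ys) (!s zs) _)))
            (!P₂ □ [] (!s ys) (castᶠ (map-++-++ _ ys) d))))))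

  swapᶠ : ∀ As Θ {Γ C} → 𝓛 ⊢ᶠ Θ ++ !s As ++ Γ ⇒ C → 𝓛 ⊢ᶠ !s As ++ Θ ++ Γ ⇒ C
  swapᶠ []       Θ     d = d
  swapᶠ (A ∷ As) Θ {Γ} d =
    castᶠ (++-assoc (fm (! A) ∷ !s As) Θ Γ)
      (!P₂ □ [] (!s As ++ Θ)
        (castᶠ (sym (++-assoc (!s As) Θ (fm (! A) ∷ Γ)))
          (swapᶠ As Θ (!P₁ □ Θ (!s As) d))))

-- Derived rules of the calculi with stoups

module _ {𝓛 : StoupCalculus} where

  wrapperLᵐ : ∀ g {ζ Γ C} → 𝓛 ⊢ᵐ ζ ⨾ emptyStoups (wrapping g) ++ Γ ⇒ C →
            𝓛 ⊢ᵐ ζ ⨾ fm (wrapper g) ∷ Γ ⇒ C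
  wrapperLᵐ g₂₀₁₅         d = 𝟙L □ [] d
  wrapperLᵐ g₂₀₁₈ {ζ} {Γ} d =
    ⟨⟩L □ [] (⟨⟩L (inside ζ [] □ Γ) [] (𝟙L (inside ζ [] (inside [] [] □ []) Γ) [] d))

  wrapperRᵐ : ∀ g → 𝓛 ⊢ᵐ [] ⨾ emptyStoups (wrapping g) ⇒ wrapper g
  wrapperRᵐ g₂₀₁₅ = 𝟙R
  wrapperRᵐ g₂₀₁₈ = ⟨⟩R (⟨⟩R 𝟙R)

  ∏Lᵐ : ∀ Δ As {ζ Γ C} → 𝓛 ⊢ᵐ ζ ⨾ Δ ++ map fm As ++ Γ ⇒ C → 𝓛 ⊢ᵐ ζ ⨾ Δ ++ fm (∏ As) ∷ Γ ⇒ C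
  ∏Lᵐ Δ []               d = 𝟙L □ Δ d
  ∏Lᵐ Δ (A ∷ As) {Γ = Γ} d = ·L □ Δ (castᵐ (++-assoc Δ [ fm A ] (fm (∏ As) ∷ Γ))
    (∏Lᵐ (Δ ++ [ fm A ]) As (castᵐ (sym (++-assoc Δ [ fm A ] (map fm As ++ Γ))) d)))

  ∏Rᵐ : ∀ As → 𝓛 ⊢ᵐ [] ⨾ map fm As ⇒ ∏ As
  ∏Rᵐ []       = 𝟙R
  ∏Rᵐ (A ∷ As) = ·R {Δ = [ fm A ]} ax (∏Rᵐ As)

  stoup∏Rᵐ : ∀ As → 𝓛 ⊢ᵐ As ⨾ [] ⇒ ∏ As
  stoup∏Rᵐ []       = 𝟙R
  stoup∏Rᵐ (A ∷ As) = ·R {Δ = []} (!P □ [] ax) (stoup∏Rᵐ As)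

  bangedLᵐ : ∀ ζ As {X Γ C} → 𝓛 ⊢ᵐ ζ ++ As ⨾ fm X ∷ Γ ⇒ C →
             𝓛 ⊢ᵐ ζ ⨾ fm (banged As X) ∷ Γ ⇒ C
  bangedLᵐ ζ []       d = exch □ (↭-reflexive (++-identityʳ ζ)) d
  bangedLᵐ ζ (A ∷ As) d = ·L □ [] (!L □ [] (bangedLᵐ (ζ ++ [ A ]) As
    (exch □ (↭-reflexive (sym (++-assoc ζ [ A ] As))) d)))

  -- The primed rules, with `ζ′` empty, give the same instance as the unprimed ones.
  contract₁ᵐ : ∀ ζ A {Γ C} → 𝓛 ⊢ᵐ ζ ++ [ A ] ⨾ br ([ A ] ⨾ []) ∷ Γ ⇒ C →
               𝓛 ⊢ᵐ ζ ++ [ A ] ⨾ emptyStoups (wrapping (generationᵐ 𝓛)) ++ Γ ⇒ C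
  contract₁ᵐ ζ A {Γ} = go 𝓛
    where
    go : ∀ 𝓛 {C} → 𝓛 ⊢ᵐ ζ ++ [ A ] ⨾ br ([ A ] ⨾ []) ∷ Γ ⇒ C →
         𝓛 ⊢ᵐ ζ ++ [ A ] ⨾ emptyStoups (wrapping (generationᵐ 𝓛)) ++ Γ ⇒ C
    go 𝓜₂₀₁₅  d = !C₂₀₁₅ □ ζ [ A ] [] [] (λ ()) d
    go 𝓜′₂₀₁₅ d = !C′₂₀₁₅ □ ζ [ A ] [] [] [] (λ ()) d
    go 𝓜₂₀₁₈  d = !C₂₀₁₈ □ ζ A [] [] d
    go 𝓜′₂₀₁₈ d = !C′₂₀₁₈ □ ζ [] A [] [] d

  contractᵐ : ∀ {A As Γ C} → A ∈ As → 𝓛 ⊢ᵐ As ⨾ br ([ A ] ⨾ []) ∷ Γ ⇒ C →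
              𝓛 ⊢ᵐ As ⨾ emptyStoups (wrapping (generationᵐ 𝓛)) ++ Γ ⇒ C
  contractᵐ {A} A∈As d with ys , zs , refl ← ∈-∃++ A∈As =
    exch □ (↭-sym last) (contract₁ᵐ (ys ++ zs) A (exch □ last d))
    -- The contraction rules take the contracted formula from the end of the list.
    where
    last : ys ++ [ A ] ++ zs ↭ (ys ++ zs) ++ [ A ]
    last = ↭-trans (shift A ys zs) (∷↭∷ʳ A (ys ++ zs))

-- Semi-Thue systems encoded as formulas

module SemiThue {Sym : Set} (code : Sym → ℕ)
                (rules : List (List Sym × List Sym))
                (accept : Sym) (prefix : List Sym) (suffix : Sym) where

  data Reduces : List Sym → Set where
    done : Reduces [ accept ]
    step : ∀ {u v} → (u , v) ∈ rules → ∀ l r →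
           Reduces (l ++ v ++ r) → Reduces (l ++ u ++ r)

  letters : ∀ {v} → List Sym → List (Formula v)
  letters = map (var ∘ code)

  letters-++ : ∀ {v} l u {r} →
               letters {v} (l ++ u ++ r) ≡ letters l ++ letters u ++ letters r
  letters-++ l u = trans (map-++ _ l _) (cong (letters l ++_) (map-++ _ u _))

  trees-++ : ∀ {X : Set} {f : Fm → X} l u {r} →
             map f (letters (l ++ u ++ r)) ≡
             map f (letters l) ++ map f (letters u) ++ map f (letters r)
  trees-++ {f = f} l u = trans (cong (map f) (letters-++ l u))
    (trans (map-++ f (letters l) _) (cong (map f (letters l) ++_) (map-++ f (letters u) _)))

  -- `box` cancels the bracket created by contraction and `token` renews the double bracket; without
  -- brackets they are `id` and `𝟙`.
  module Encoding {v} (box : Formula v → Formula v) (token : Formula v) where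

    rewriting : List Sym × List Sym → Formula v
    rewriting (u , v) = ∏ (letters v) / ∏ (letters u)

    axiom : List Sym × List Sym → Formula v
    axiom r = box (token · ! rewriting r)

    axioms : List (Formula v)
    axioms = map axiom rules

    -- Contractions leave the original copies of the axioms and one copy of the
    -- token behind; the goal absorbs them.
    target : Formula v
    target = token · (var (code accept) · ∏ axioms)

    -- The token here pays for the first contraction.
    source : Formula v
    source = token · ∏ (letters prefix)

    -- The lexicon supplies only the letters of the word. The implications add the axioms and
    -- `prefix` on the left and `suffix` on the right.
    goal : Formula v
    goal = banged axioms source ∖ (target / var (code suffix))

    module _ {S : Set} (sem : Sym → Rel S 0ℓ)
             (code-injective : Injective _≡_ _≡_ code)
             (valid : All (λ (u , v) → ∀ {x y} → Chain sem u x y → Chain sem v x y) rules)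
             where

      -- Variables are numbers, so the symbol is recovered from its code; numbers that code nothing
      -- denote the empty relation.
      ρ : ℕ → Rel S 0ℓ
      ρ n x y = ∃ λ s → code s ≡ n × sem s x y

      open Interpretation ρ

      word⁺ : ∀ {w x y} → Chain sem w x y → Chain ⟦_⟧ (letters {v} w) x y
      word⁺ []      = []
      word⁺ (a ∷ c) = (_ , refl , a) ∷ word⁺ c

      ρ⁻ : ∀ s {x y} → ρ (code s) x y → sem s x y
      ρ⁻ s (t , eq , a) with refl ← code-injective eq = a

      word⁻ : ∀ w {x y} → ⟦ ∏ (letters {v} w) ⟧ x y → Chain sem w x y
      word⁻ []      refl        = []
      word⁻ (s ∷ w) (_ , a , c) = ρ⁻ s a ∷ word⁻ w c

      module _ (box⁺ : ∀ {A x} → ⟦ A ⟧ x x → ⟦ box A ⟧ x x)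
               (token-unit : ∀ {x y} → ⟦ token ⟧ x y ≡ (x ≡ y))
               where

        token⁺ : ∀ {x} → ⟦ token ⟧ x x
        token⁺ = subst id (sym token-unit) refl

        token⁻ : ∀ {x y} → ⟦ token ⟧ x y → x ≡ y
        token⁻ = subst id token-unit

        -- `C / A` relates `z` to itself when every `A`-step from `z` is also a `C`-step, so the
        -- inclusion of chains is exactly what `rewriting` needs.
        axiom-valid : ∀ {r} → (∀ {x y} → Chain sem (proj₁ r) x y → Chain sem (proj₂ r) x y) →
                      Valid (axiom r)
        axiom-valid h x = box⁺ (_ , token⁺ , refl , λ z w a → ∏⁺ (word⁺ (h (word⁻ _ a))))

        -- Given `source` from `x₀` to `x` and the suffix from `y` to `z`, the goal yields `target`
        -- from `x₀` to `z`. Its token is an identity and its axioms are dropped, so only the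
        -- starting point of the accepting step is known.
        faithful : ∀ {w x₀ x y z} →
                   (Chain ⟦_⟧ (letters {v} w) x y → ⟦ goal ⟧ x y) →
                   Chain sem prefix x₀ x → Chain sem w x y → sem suffix y z →
                   ∃ (sem accept x₀)
        faithful d p c s
          with _ , k , _ , a , _ ← d (word⁺ c) _
                 (banged⁺ (All.map⁺ (All.map axiom-valid valid)) (_ , token⁺ , ∏⁺ (word⁺ p)))
                 _ (_ , refl , s)
          with refl ← token⁻ k = _ , ρ⁻ accept a

  -- Simulation of reductions by derivations

  module _ {𝓛 : BracketFreeCalculus} where

    open Encoding {bracketFree} id 𝟙

    private
      P : List (Formula bracketFree)
      P = map !_ axioms

    -- Read upwards, one step copies an axiom, unpacks it, carries `! rewriting` past `l`, and
    -- replaces `u` by `v` with `/L`; the originals stay in `P` for the next step.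
    simulateᵉ : ∀ {w} → Reduces w → 𝓛 ⊢ᵉ P ++ letters w ⇒ target
    simulateᵉ done = swapᵉ axioms (·R 𝟙R (·R {Γ = [ _ ]} ax
      (castᵉ (sym (++-identityʳ P)) (!∏Rᵉ axioms))))
    simulateᵉ (step {u} {v} r∈ l r d) =
      castᵉ (cong (P ++_) (sym (letters-++ l u)))
        (contractᵉ (∈-map⁺ axiom r∈) (!L P (·L P (𝟙L P (!P₂ P (letters l)
          (castᵉ (++-assoc P (letters l) _)
            (!L (P ++ letters l) (/L (P ++ letters l) (∏Rᵉ (letters u))
              (∏Lᵉ (P ++ letters l) (letters v)
                (castᵉ
                  (trans (cong (P ++_) (letters-++ l v)) (sym (++-assoc P (letters l) _)))
                  (simulateᵉ d)))))))))))

    derivableᵉ : ∀ w → Reduces (prefix ++ w ++ [ suffix ]) → 𝓛 ⊢ᵉ letters w ⇒ goal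
    derivableᵉ w d = ∖R (/R (bangedLᵉ [] axioms (·L P (𝟙L P (∏Lᵉ P (letters prefix)
      (castᵉ (cong (P ++_) (letters-++ prefix w)) (simulateᵉ d)))))))

  module _ {𝓛 : StoupFreeCalculus} where

    open Encoding {bracketed} []⁻¹_ (wrapper (generationᶠ 𝓛))

    private
      P : List Tree
      P = !s axioms

      T : List Tree
      T = wrapping (generationᶠ 𝓛)

      trees : List Sym → List Tree
      trees w = map fm (letters w)

      Q : List Tree
      Q = P ++ T

    -- The invariant keeps one wrapping `T` after the axioms: contraction consumes it, unpacking the
    -- token of the copy restores it, and the token of the target absorbs the last one.
    simulateᶠ : ∀ {w} → Reduces w → 𝓛 ⊢ᶠ P ++ T ++ trees w ⇒ target
    simulateᶠ done = castᶠ (cong (P ++_) (++-identityʳ (T ++ _)))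
      (swapᶠ axioms (T ++ _) (castᶠ (sym (++-assoc T [ _ ] _))
        (·R (wrapperRᶠ (generationᶠ 𝓛)) (·R {Δ = [ _ ]} ax
          (castᶠ (sym (++-identityʳ P)) (!∏Rᶠ axioms))))))
    simulateᶠ (step {u} {v} r∈ l r d) =
      castᶠ (cong (λ Γ → P ++ T ++ Γ) (sym (trees-++ l u)))
        (contractᶠ (∈-map⁺ axiom r∈) (!L (inside P □ _) []
          ([]⁻¹L □ P (·L □ P (wrapperLᶠ (generationᶠ 𝓛) P (castᶠ (++-assoc P T _)
            (!P₂ □ Q (trees l)
              (castᶠ (++-assoc Q (trees l) _)
                (!L □ (Q ++ trees l) (/L □ (Q ++ trees l) (∏Rᶠ (letters u))
                  (∏Lᶠ (Q ++ trees l) (letters v)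
                    (castᶠ
                      (trans (sym (++-assoc P T _))
                        (trans (cong (Q ++_) (trees-++ l v)) (sym (++-assoc Q (trees l) _))))
                      (simulateᶠ d)))))))))))))

    derivableᶠ : ∀ w → Reduces (prefix ++ w ++ [ suffix ]) → 𝓛 ⊢ᶠ trees w ⇒ goal
    derivableᶠ w d = ∖R (/R (bangedLᶠ [] axioms (·L □ P (wrapperLᶠ (generationᶠ 𝓛) P
      (castᶠ (++-assoc P T _) (∏Lᶠ Q (letters prefix)
        (castᶠ
          (trans (cong (λ Γ → P ++ T ++ Γ) (trees-++ prefix w)) (sym (++-assoc P T _)))
          (simulateᶠ d))))))))

  module _ {𝓛 : StoupCalculus} where

    open Encoding {bracketed} []⁻¹_ (wrapper (generationᵐ 𝓛))

    private
      T : List STree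
      T = emptyStoups (wrapping (generationᵐ 𝓛))

      trees : List Sym → List STree
      trees w = map fm (letters w)

    -- The stoup does the transport: `!P` releases the copy inside its bracket, and `!L` followed by
    -- `!P` carries the unpacked rewriting formula past `l`.
    simulateᵐ : ∀ {w} → Reduces w → 𝓛 ⊢ᵐ axioms ⨾ T ++ trees w ⇒ target
    simulateᵐ done = ·R (wrapperRᵐ (generationᵐ 𝓛)) (·R {Δ = [ _ ]} ax (stoup∏Rᵐ axioms))
    simulateᵐ (step {u} {v} r∈ l r d) =
      castᵐ (cong (T ++_) (sym (trees-++ l u)))
        (contractᵐ (∈-map⁺ axiom r∈) (!P (inside axioms [] □ _) []
          ([]⁻¹L □ [] (·L □ [] (wrapperLᵐ (generationᵐ 𝓛) (!L □ T (castᵐ (++-assoc T (trees l) _) (!P □ (T ++ trees l)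
            (/L □ (T ++ trees l) (∏Rᵐ (letters u)) (∏Lᵐ (T ++ trees l) (letters v)
              (castᵐ (trans (cong (T ++_) (trees-++ l v)) (sym (++-assoc T (trees l) _)))
                (simulateᵐ d))))))))))))

    derivableᵐ : ∀ w → Reduces (prefix ++ w ++ [ suffix ]) → 𝓛 ⊢ᵐ [] ⨾ trees w ⇒ goal
    derivableᵐ w d = ∖R (/R (bangedLᵐ [] axioms (·L □ [] (wrapperLᵐ (generationᵐ 𝓛)
      (∏Lᵐ T (letters prefix) (castᵐ (cong (T ++_) (trees-++ prefix w)) (simulateᵐ d)))))))

-- Turing machines as rewriting systems

module Machine {k : ℕ} (T : TuringMachine k) where

  open TuringMachine T

  data Sym : Set where
    ⊳ ⊲ ✓ : Sym
    cell  : Cell → Sym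
    state : State → Sym

  cells : List Cell
  cells = blank ∷ map input (allFin _) ++ map work (allFin _)

  ∈-cells : ∀ z → z ∈ cells
  ∈-cells blank     = here refl
  ∈-cells (input a) = there (∈-++⁺ˡ (∈-map⁺ input (∈-allFin a)))
  ∈-cells (work b)  = there (∈-++⁺ʳ (map input (allFin _)) (∈-map⁺ work (∈-allFin b)))

  syms : List Sym
  syms = ⊳ ∷ ⊲ ∷ ✓ ∷ map cell cells ++ map state (allFin _)

  ∈-syms : ∀ s → s ∈ syms
  ∈-syms ⊳         = here refl
  ∈-syms ⊲         = there (here refl)
  ∈-syms ✓         = there (there (here refl))
  ∈-syms (cell z)  = there (there (there (∈-++⁺ˡ (∈-map⁺ cell (∈-cells z)))))
  ∈-syms (state q) = there (there (there (∈-++⁺ʳ (map cell cells) (∈-map⁺ state (∈-allFin q)))))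

  code : Sym → ℕ
  code s = toℕ (index (∈-syms s))

  code-injective : Injective _≡_ _≡_ code
  code-injective {s} {t} eq = trans (lookup-index (∈-syms s))
    (trans (cong (lookup syms) (toℕ-injective eq)) (sym (lookup-index (∈-syms t))))

  -- The rewriting rules of a machine

  data Instruction : Set where
    move        : State → Cell → Cell → Instruction
    moveEnd     : State → Cell → Instruction
    extend halt : State → Instruction
    eatCell     : Cell → Instruction
    eatAfter    : Sym → Instruction
    eatStart    : Instruction

  instructionLists : List (List Instruction)
  instructionLists =
    cartesianProductWith _$_ (cartesianProductWith move (allFin _) cells) cells ∷
    cartesianProductWith moveEnd (allFin _) cells ∷
    map extend (allFin _) ∷
    map halt (allFin _) ∷
    map eatCell cells ∷
    map eatAfter syms ∷
    [ eatStart ] ∷ []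

  instructions : List Instruction
  instructions = concat instructionLists

  ∈-instructions : ∀ i → i ∈ instructions
  ∈-instructions i = let _ , i∈ , is∈ = find i in ∈-concat⁺′ i∈ is∈
    where
    find : ∀ i → ∃ λ is → i ∈ is × is ∈ instructionLists
    find (move q x z)  = _ , ∈-cartesianProductWith⁺ _$_
      (∈-cartesianProductWith⁺ move (∈-allFin q) (∈-cells x)) (∈-cells z) , here refl
    find (moveEnd q x) =
      _ , ∈-cartesianProductWith⁺ moveEnd (∈-allFin q) (∈-cells x) , there (here refl)
    find (extend q)    = _ , ∈-map⁺ extend (∈-allFin q) , there (there (here refl))
    find (halt q)      = _ , ∈-map⁺ halt (∈-allFin q) , there (there (there (here refl)))
    find (eatCell z)   = _ , ∈-map⁺ eatCell (∈-cells z) , there (there (there (there (here refl))))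
    find (eatAfter s)  =
      _ , ∈-map⁺ eatAfter (∈-syms s) , there (there (there (there (there (here refl)))))
    find eatStart      =
      _ , here refl , there (there (there (there (there (there (here refl))))))

  Action : Set
  Action = Maybe (State × Cell × Move)

  -- The value of `δ` is a separate argument so that the equation given by a machine step can be
  -- substituted with `cong`.
  moveRule : State → Cell → Cell → Action → List Sym × List Sym
  moveRule q x z (just (p , y , left))  =
    cell z ∷ state q ∷ cell x ∷ [] , state p ∷ cell z ∷ cell y ∷ []
  moveRule q x z (just (p , y , right)) = state q ∷ cell x ∷ [] , cell y ∷ state p ∷ []
  moveRule q x z nothing                = [] , []

  -- At the left end of the written tape, a left move has to create the blank it arrives at.
  moveEndRule : State → Cell → Action → List Sym × List Sym
  moveEndRule q x (just (p , y , left)) =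
    ⊳ ∷ state q ∷ cell x ∷ [] , ⊳ ∷ state p ∷ cell blank ∷ cell y ∷ []
  moveEndRule q x _                     = [] , []

  haltRule : ∀ q → Dec (q Subset.∈ final) → List Sym × List Sym
  haltRule q (yes _) = [ state q ] , [ ✓ ]
  haltRule q (no _)  = [] , []

  -- Instructions that do not apply become the harmless rule [] → [].
  rule : Instruction → List Sym × List Sym
  rule (move q x z)  = moveRule q x z (δ q x)
  rule (moveEnd q x) = moveEndRule q x (δ q x)
  rule (extend q)    = state q ∷ ⊲ ∷ [] , state q ∷ cell blank ∷ ⊲ ∷ []
  rule (halt q)      = haltRule q (q ∈? final)
  rule (eatCell z)   = cell z ∷ ✓ ∷ [] , [ ✓ ]
  rule eatStart      = ⊳ ∷ ✓ ∷ [] , [ ✓ ]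
  rule (eatAfter s)  = ✓ ∷ s ∷ [] , [ ✓ ]

  rules : List (List Sym × List Sym)
  rules = map rule instructions

  ∈-rules : ∀ i → rule i ∈ rules
  ∈-rules i = ∈-map⁺ rule (∈-instructions i)

  open SemiThue code rules ✓ (⊳ ∷ state start ∷ []) ⊲ public

  -- Accepting runs yield reductions

  apply : ∀ i {u v} → rule i ≡ (u , v) → ∀ l r → Reduces (l ++ v ++ r) → Reduces (l ++ u ++ r)
  apply i refl = step (∈-rules i)

  -- With `ʳ++`, `tape (z ∷ ls) w` is `tape ls (cell z ∷ w)` by computation, so a redex may begin
  -- left of the head.
  tape : List Cell → List Sym → List Sym
  tape ls w = ⊳ ∷ map cell ls ʳ++ w

  applyInside : ∀ i {u v} → rule i ≡ (u , v) → ∀ ls r →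
                Reduces (tape ls (v ++ r)) → Reduces (tape ls (u ++ r))
  applyInside i {u} {v} eq ls r d
    rewrite ʳ++-defn (map cell ls) {u ++ r} | ʳ++-defn (map cell ls) {v ++ r} =
    apply i eq (⊳ ∷ reverse (map cell ls)) r d

  around : List Cell → State → List Cell → List Sym
  around ls q rs = tape ls (state q ∷ map cell rs ++ [ ⊲ ])

  describe : Config → List Sym
  describe (config q ls x rs) = around ls q (x ∷ rs)

  -- A head beyond the written part scans an implicit blank, which `extend` writes down.
  extended : ∀ ls q rs → Reduces (around ls q (nearest rs ∷ drop 1 rs)) →
             Reduces (around ls q rs)
  extended ls q []      = applyInside (extend q) refl ls []
  extended ls q (_ ∷ _) = id

  reduces-step : ∀ {c c′} → c ⟶ c′ → Reduces (describe c′) → Reduces (describe c)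
  reduces-step (step {q} {x} {ls} {rs} {p , y , right} eq) d =
    -- `blank` is an arbitrary choice: for a right move the rule is the same for every left
    -- neighbour.
    applyInside (move q x blank) (cong (moveRule q x blank) eq) ls (map cell rs ++ [ ⊲ ])
      (extended (y ∷ ls) p rs d)
  reduces-step (step {q} {x} {[]} {rs} {p , y , left} eq) d =
    apply (moveEnd q x) (cong (moveEndRule q x) eq) [] (map cell rs ++ [ ⊲ ]) d
  reduces-step (step {q} {x} {z ∷ ls} {rs} {p , y , left} eq) d =
    applyInside (move q x z) (cong (moveRule q x z) eq) ls (map cell rs ++ [ ⊲ ]) d

  eatenAfter : ∀ ls w → Reduces (tape ls [ ✓ ]) → Reduces (tape ls (✓ ∷ w))
  eatenAfter ls []      d = d
  eatenAfter ls (s ∷ w) d = applyInside (eatAfter s) refl ls w (eatenAfter ls w d)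

  eaten : ∀ ls → Reduces (tape ls [ ✓ ])
  eaten []       = apply eatStart refl [] [] done
  eaten (z ∷ ls) = applyInside (eatCell z) refl ls [] (eaten ls)

  reduces-final : ∀ c → Config.state c Subset.∈ final → Reduces (describe c)
  reduces-final (config q ls x rs) q∈ =
    -- `✓` erases everything to its right, then the cells to its left, and finally `⊳`.
    applyInside (halt q) isFinal ls _ (eatenAfter ls _ (eaten ls))
    where
    isFinal : rule (halt q) ≡ ([ state q ] , [ ✓ ])
    isFinal with q ∈? final
    ... | yes _ = refl
    ... | no q∉ with () ← q∉ q∈

  reduces-run : ∀ {c c′} → Star _⟶_ c c′ → Config.state c′ Subset.∈ final → Reduces (describe c)
  reduces-run {c} ε q∈ = reduces-final c q∈
  reduces-run (s ◅ ss) q∈ = reduces-step s (reduces-run ss q∈)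

  accepted⇒reduces : ∀ {w} → Accepted w → Reduces (around [] start (map input w))
  -- For the empty word, the initial configuration scans a blank that is not yet written.
  accepted⇒reduces (_ , run , q∈) = extended [] start _ (reduces-run run q∈)

  -- The model on parts of configurations

  Accepting : Config → Set
  Accepting c = ∃ λ d → Star _⟶_ c d × Config.state d Subset.∈ final

  at : State → List Cell → List Cell → Config
  at q ls rs = config q ls (nearest rs) (drop 1 rs)

  -- A point stands for a suffix of ⊳ l q r ⊲.  `rest r` is r ⊲ (or the empty word);
  -- a suffix that contains the state is a `head`, which maps the cells missing on
  -- the left, nearest first, to the configuration they complete it to.
  data Point : Set where
    rest : List Cell → Point
    head : (List Cell → Config) → Point

  -- Left of the head, a symbol carries acceptance back from the shorter suffix to the longer one:
  -- `cell z` adds `z` to the missing cells, and `⊳` says that none are missing. Implications,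
  -- rather than equal configurations, let a rule replace a configuration by its successor.
  data sem : Sym → Rel Point 0ℓ where
    ⊳     : ∀ {f g} → (Accepting (g []) → ∀ ls → Accepting (f ls)) → sem ⊳ (head f) (head g)
    ⊲     : ∀ {y} → sem ⊲ (rest []) y
    -- y is unconstrained: the goal lets other formulas follow ✓.
    ✓     : ∀ {f y} → (∀ ls → Accepting (f ls)) → sem ✓ (head f) y
    cellˡ : ∀ {z f g} → (∀ ls → Accepting (g (z ∷ ls)) → Accepting (f ls)) →
            sem (cell z) (head f) (head g)
    cellʳ : ∀ {z rs} → sem (cell z) (rest (z ∷ rs)) (rest rs)
    state : ∀ {q f rs} → (∀ ls → Accepting (at q ls rs) → Accepting (f ls)) →
            sem (state q) (head f) (rest rs)

  Sound : List Sym × List Sym → Set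
  Sound (u , v) = ∀ {x y} → Chain sem u x y → Chain sem v x y

  accepting-step : ∀ {q x a ls rs} → δ q x ≡ just a →
                   Accepting (perform a ls rs) → Accepting (config q ls x rs)
  accepting-step eq (c , run , q∈) = c , step eq ◅ run , q∈

  sound-rule : ∀ i → Sound (rule i)
  sound-rule (move q x z) with δ q x in eq
  ... | nothing = id
  ... | just (p , y , left)  = λ { (cellˡ f ∷ state a ∷ cellʳ ∷ []) →
    state (λ ls h → f ls (a (z ∷ ls) (accepting-step eq h))) ∷ cellʳ ∷ cellʳ ∷ [] }
  ... | just (p , y , right) = λ { (state {rs = _ ∷ rs} a ∷ cellʳ ∷ []) →
    -- The point between `y` and `p` has to be invented; with `y` added on the left it describes the
    -- successor configuration.
    cellˡ {g = λ ls → at p ls rs} (λ ls h → a ls (accepting-step eq h)) ∷ state (λ _ → id) ∷ [] }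
  sound-rule (moveEnd q x) with δ q x in eq
  ... | nothing = id
  ... | just (p , y , left)  = λ { (⊳ f ∷ state a ∷ cellʳ ∷ []) →
    ⊳ {g = λ ls → at p ls (blank ∷ y ∷ _)} (λ h → f (a [] (accepting-step eq h))) ∷
    state (λ _ → id) ∷ cellʳ ∷ cellʳ ∷ [] }
  ... | just (p , y , right) = id
  -- `at q ls []` and `at q ls (blank ∷ [])` are the same configuration by computation.
  sound-rule (extend q) (state a ∷ ⊲ ∷ []) = state a ∷ cellʳ ∷ ⊲ ∷ []
  sound-rule (halt q) with q ∈? final
  ... | yes q∈ = λ { (state a ∷ []) → ✓ (λ ls → a ls (_ , ε , q∈)) ∷ [] }
  ... | no _   = id
  sound-rule (eatCell z) (cellˡ f ∷ ✓ h ∷ []) = ✓ (λ ls → f ls (h (z ∷ ls))) ∷ []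
  sound-rule eatStart (⊳ f ∷ ✓ h ∷ []) = ✓ (f (h [])) ∷ []
  sound-rule (eatAfter s) (✓ h ∷ _ ∷ []) = ✓ h ∷ []

  sound-rules : All Sound rules
  sound-rules = All.map⁺ (All.universal sound-rule instructions)

  -- The grammars and the languages they generate

  word : List (Fin k) → List Sym
  word w = map cell (map input w)

  rest-word : ∀ rs → Chain sem (map cell rs) (rest rs) (rest [])
  rest-word []       = []
  rest-word (z ∷ rs) = cellʳ ∷ rest-word rs

  module _ {v} (box : Formula v → Formula v) (token : Formula v) where

    open Encoding box token

    grammar : Grammar v k
    grammar = record
      { lexicon = map (λ a → a , var (code (cell (input a)))) (allFin k)
      ; goal    = goal
      }

    open Grammar grammar using (_▷*_)

    lexicon-complete : ∀ w → w ▷* letters (word w)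
    lexicon-complete []      = []
    lexicon-complete (a ∷ w) = ∈-map⁺ _ (∈-allFin a) ∷ lexicon-complete w

    lexicon-unique : ∀ {w As} → w ▷* As → As ≡ letters (word w)
    lexicon-unique []       = refl
    lexicon-unique (p ∷ ps) with _ , _ , refl ← ∈-map⁻ _ p = cong (_ ∷_) (lexicon-unique ps)

    open Interpretation (ρ sem code-injective sound-rules)

    accepted : (∀ {A x} → ⟦ A ⟧ x x → ⟦ box A ⟧ x x) →
               (∀ {x y} → ⟦ token ⟧ x y ≡ (x ≡ y)) →
               ∀ {w As} → w ▷* As →
               (∀ {x y} → Chain ⟦_⟧ As x y → ⟦ goal ⟧ x y) → Accepted w
    accepted box⁺ token-unit {w} p d
      with refl ← lexicon-unique p
      with _ , ✓ h ← faithful sem code-injective sound-rules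
             box⁺ token-unit {word w} {head λ _ → initial w} d
             -- With no missing cells, `at start [] (map input w)` is `initial w` by computation.
             (⊳ {g = λ ls → at start ls (map input w)} (λ h _ → h) ∷ state (λ _ → id) ∷ [])
             (rest-word (map input w)) (⊲ {rest []}) = h []

  recognizedᵉ : ∀ 𝓛 → recognized 𝓛 (grammar id 𝟙) ≐ Accepted
  recognizedᵉ 𝓛 =
    (λ (_ , p , d) → accepted id 𝟙 id refl p (Interpretation.soundᵉ _ d)) ,
    (λ {w} a → _ , lexicon-complete id 𝟙 w , derivableᵉ (word w) (accepted⇒reduces a))

  bracketedGrammar : BracketedCalculus → Grammar bracketed k
  bracketedGrammar 𝓛 = grammar []⁻¹_ (wrapper (generation 𝓛))

  derivable : ∀ 𝓛 w → Accepted w →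
              𝓛 ⊢ map fm (letters (word w)) ⇒ Grammar.goal (bracketedGrammar 𝓛)
  derivable (stoup 𝓛)     w a =
    castᵐ (sym (emptyStoups-fm (letters (word w)))) (derivableᵐ (word w) (accepted⇒reduces a))
  derivable (stoupFree 𝓛) w a = derivableᶠ (word w) (accepted⇒reduces a)

  module _ (𝓛 : BracketedCalculus) where

    private
      G : Grammar bracketed k
      G = bracketedGrammar 𝓛

    accepted⇒s : ∀ {w} → Accepted w → s-recognized 𝓛 G w
    accepted⇒s {w} a = _ , lexicon-complete []⁻¹_ (wrapper (generation 𝓛)) w , derivable 𝓛 w a

    s⇒t : ∀ {w} → s-recognized 𝓛 G w → t-recognized 𝓛 G w
    s⇒t {w} (As , p , d) = map fm As , subst (Grammar._▷*_ G w) (sym (debracket-fm As)) p , d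

    t⇒accepted : ∀ {w} → t-recognized 𝓛 G w → Accepted w
    t⇒accepted (Π , p , d) =
      accepted []⁻¹_ _ id (wrapper-unit (generation 𝓛)) p (Interpretation.sound _ 𝓛 d)

theorem11 : ∀ {ℓ} (k : ℕ) (M : Pred (List (Fin k)) ℓ) → RecursivelyEnumerable M →
    (∃ λ (G : Grammar bracketFree k) → recognized 𝓔 G ≐ M) ×
    (∃ λ (G : Grammar bracketFree k) → recognized 𝓔ʳ G ≐ M) ×
    (∀ (𝓛 : BracketedCalculus) →
    ∃ λ (G : Grammar bracketed k) → (s-recognized 𝓛 G ≐ M) × (t-recognized 𝓛 G ≐ M))
theorem11 k M (T , accepts) =
  (_ , ≐-trans (recognizedᵉ 𝓔) accepts) ,
  (_ , ≐-trans (recognizedᵉ 𝓔ʳ) accepts) ,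
  λ 𝓛 → bracketedGrammar 𝓛 ,
    -- Acceptance gives s-recognition, which gives t-recognition, which gives acceptance; this cycle
    -- settles both equalities.
    ≐-trans (t⇒accepted 𝓛 ∘ s⇒t 𝓛 , accepted⇒s 𝓛) accepts ,
    ≐-trans (t⇒accepted 𝓛 , s⇒t 𝓛 ∘ accepted⇒s 𝓛) accepts
  where open Machine T
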